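{- The $3$-MEDA problem (Minimum Exact Diameter-$3$ Augmentation) is solvable in polynomial time. That is, there is a polynomial-time algorithm which, given a connected graph $G$ and a positive integer $k$, decides whether there is a set $F\subseteq E(G)$ such that $|F|\le k$ and $G-F$ is a connected graph of diameter exactly $3$.
   Context: All graphs are finite, simple and undirected. For $F\subseteq E(G)$, $G-F$ is the graph with vertex set $V(G)$ and edge set $E(G)\setminus F$. The diameter of a connected graph $G$ is $\mathrm{diam}(G)=\max_{u,v\in V(G)}\mathrm{dist}_G(u,v)$, where $\mathrm{dist}_G(u,v)$ is the minimum number of edges of a $u,v$-path. For a fixed positive integer $d$, the Minimum Exact Diameter-$d$ Augmentation problem ($d$-MEDA) is the following decision problem. Input: a connected graph $G$ and a positive integer $k$. Question: is there a set $F\subseteq E(G)$ such that $|F|\le k$ and $G-F$ is a connected graph of diameter $d$? -}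

module Defs where

open import Data.Bool using (Bool; false; T; _∧_; not; if_then_else_)
open import Data.Fin using (Fin; _<?_)
open import Data.List using (List; []; _∷_; map; foldr; sum; length; filter; head; last; drop; allFin; cartesianProduct)
open import Data.List.Relation.Unary.Linked using (Linked)
open import Data.List.Relation.Unary.Unique.Propositional using (Unique)
open import Data.Maybe using (Maybe; just; nothing; maybe′)
open import Data.Nat using (ℕ; zero; suc; _+_; _*_; _∸_; _≤_; _<_; _≡ᵇ_)
open import Data.Nat.Logarithm using (⌊log₂_⌋)
open import Data.Product using (_×_; _,_; ∃; ∃-syntax; ∃₂)
open import Data.Sum using (_⊎_; inj₁; inj₂; [_,_]′)
open import Relation.Binary.PropositionalEquality using (_≡_; cong; cong₂)
open import Relation.Nullary using (Reflects)
open import Relation.Nullary.Decidable using (T?; _×-dec_)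

------------------------------------------------------------------------
-- Finite simple graphs

-- A set of unordered pairs of distinct elements of Fin n.
record EdgeSet (n : ℕ) : Set where
  field
    has         : Fin n → Fin n → Bool
    symmetric   : ∀ u v → has u v ≡ has v u
    irreflexive : ∀ v → has v v ≡ false

open EdgeSet public

-- A graph with vertex set Fin n is determined by its edge set.
Graph : ℕ → Set
Graph = EdgeSet

private
  variable
    n : ℕ

-- Each unordered pair is listed once, smaller endpoint first.
edges : EdgeSet n → List (Fin n × Fin n)
edges {n} E =
  filter (λ (u , v) → (u <? v) ×-dec T? (has E u v))
         (cartesianProduct (allFin n) (allFin n))

∣_∣ : EdgeSet n → ℕ
∣ E ∣ = length (edges E)

Adj : Graph n → Fin n → Fin n → Set
Adj G u v = T (has G u v)

_⊆_ : EdgeSet n → EdgeSet n → Set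
F ⊆ E = ∀ u v → T (has F u v) → T (has E u v)

_─_ : Graph n → EdgeSet n → Graph n
G ─ F = record
  { has         = λ u v → has G u v ∧ not (has F u v)
  ; symmetric   = λ u v → cong₂ (λ a b → a ∧ not b) (symmetric G u v) (symmetric F u v)
  ; irreflexive = λ v → cong (_∧ not (has F v v)) (irreflexive G v)
  }

-- Path G u v ℓ: a u,v-path with ℓ edges, given by its vertex sequence u ∷ ws.
Path : Graph n → Fin n → Fin n → ℕ → Set
Path G u v ℓ = ∃[ ws ] Linked (Adj G) (u ∷ ws)
                     × Unique (u ∷ ws)
                     × last (u ∷ ws) ≡ just v
                     × length ws ≡ ℓ

-- As usual, a connected graph has at least one vertex.
Connected : Graph n → Set
Connected {n} G = 0 < n × (∀ u v → ∃ (Path G u v))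

IsDist : Graph n → Fin n → Fin n → ℕ → Set
IsDist G u v ℓ = Path G u v ℓ × (∀ m → Path G u v m → ℓ ≤ m)

-- Meant for connected graphs: pairs at infinite distance are not seen.
IsDiam : Graph n → ℕ → Set
IsDiam G d = (∃₂ λ u v → IsDist G u v d) × (∀ u v ℓ → IsDist G u v ℓ → ℓ ≤ d)

------------------------------------------------------------------------
-- Random access machines (Cook and Reckhow, 1973)

-- Registers hold natural numbers, so subtraction is truncated.  There is no
-- multiplication: in t steps register contents grow by O(t) bits, so counting
-- steps agrees with Turing machine time up to a polynomial.
data Instr : Set where
  const  : (i c : ℕ)   → Instr   -- Xᵢ ← c
  add    : (i j k : ℕ) → Instr   -- Xᵢ ← Xⱼ + Xₖ
  sub    : (i j k : ℕ) → Instr   -- Xᵢ ← Xⱼ ∸ Xₖ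
  load   : (i j : ℕ)   → Instr   -- Xᵢ ← X_{Xⱼ}
  store  : (i j : ℕ)   → Instr   -- X_{Xᵢ} ← Xⱼ
  jump   : (i l : ℕ)   → Instr   -- if Xᵢ > 0 go to instruction l
  read   : (i : ℕ)     → Instr   -- Xᵢ ← next input number (0 if none is left)
  answer : (b : Bool)  → Instr   -- halt with answer b

Program : Set
Program = List Instr

record Config : Set where
  constructor config
  field
    pc    : ℕ
    regs  : ℕ → ℕ
    input : List ℕ

open Config public

_[_↦_] : (ℕ → ℕ) → ℕ → ℕ → (ℕ → ℕ)
(r [ i ↦ x ]) j = if j ≡ᵇ i then x else r j

step : Instr → Config → Bool ⊎ Config
step (const i c) (config p r inp) = inj₂ (config (suc p) (r [ i ↦ c ]) inp)
step (add i j k) (config p r inp) = inj₂ (config (suc p) (r [ i ↦ r j + r k ]) inp)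
step (sub i j k) (config p r inp) = inj₂ (config (suc p) (r [ i ↦ r j ∸ r k ]) inp)
step (load i j)  (config p r inp) = inj₂ (config (suc p) (r [ i ↦ r (r j) ]) inp)
step (store i j) (config p r inp) = inj₂ (config (suc p) (r [ r i ↦ r j ]) inp)
step (jump i l)  (config p r inp) = inj₂ (config (if r i ≡ᵇ 0 then suc p else l) r inp)
step (read i)    (config p r [])        = inj₂ (config (suc p) (r [ i ↦ 0 ]) [])
step (read i)    (config p r (x ∷ inp)) = inj₂ (config (suc p) (r [ i ↦ x ]) inp)
step (answer b)  _                = inj₁ b

-- The answer given within t steps, if any.  A program whose counter leaves
-- the instruction list gives no answer.
run : Program → ℕ → Config → Maybe Bool
run P zero    c = nothing
run P (suc t) c =
  maybe′ (λ i → [ just , run P t ]′ (step i c)) nothing (head (drop (pc c) P))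

initial : List ℕ → Config
initial inp = config 0 (λ _ → 0) inp

------------------------------------------------------------------------
-- Polynomial-time decidability

record Problem : Set₁ where
  field
    Instance : Set
    encode   : Instance → List ℕ
    Yes      : Instance → Set

-- Total number of binary digits (0 counts as one digit).
size : List ℕ → ℕ
size inp = sum (map (λ x → suc ⌊log₂ x ⌋) inp)

-- The polynomial with coefficients as, constant term first.
eval : List ℕ → ℕ → ℕ
eval as x = foldr (λ a y → a + x * y) 0 as

PolynomialTime : Problem → Set
PolynomialTime Π =
  ∃[ P ] ∃[ p ] ∀ (x : Instance) →
    ∃[ b ] run P (eval p (size (encode x))) (initial (encode x)) ≡ just b
         × Reflects (Yes x) b
  where open Problem Π

------------------------------------------------------------------------
-- Minimum Exact Diameter-d Augmentation

record MEDAInstance : Set where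
  field
    order     : ℕ
    graph     : Graph order
    budget    : ℕ
    connected : Connected graph
    positive  : 0 < budget

-- The number of vertices, the budget, and the adjacency matrix row by row.
encodeMEDA : MEDAInstance → List ℕ
encodeMEDA I =
  order ∷ budget ∷
  map (λ (u , v) → if has graph u v then 1 else 0)
      (cartesianProduct (allFin order) (allFin order))
  where open MEDAInstance I

MEDA : ℕ → Problem
MEDA d = record
  { Instance = MEDAInstance
  ; encode   = encodeMEDA
  ; Yes      = λ I → let open MEDAInstance I in
      ∃[ F ] F ⊆ graph × ∣ F ∣ ≤ budget × Connected (graph ─ F) × IsDiam (graph ─ F) d
  }

{-# OPTIONS --safe #-}
-- Deleting edges never shortens a distance.  So if G − F has diameter 3, with u and v at
-- distance 3 in it, one may undelete every edge that does not serve to keep u and v apart: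
-- what must go is the edge uv and, for each common neighbour w of u and v, one of uw and vw.
-- Hence the least |F| for a given pair is |N(u) ∩ N[v]|, and the question is whether the
-- common neighbours can be split between u and v such that all distances stay at most 3.
-- If G has diameter 2, this holds if and only if there is an edge xy with x next to u and
-- y next to v such that every neighbour of exactly one of u, v is within distance 2, in
-- G − {u, v}, of a neighbour of the other one (excluding x or y respectively), and every
-- common neighbour is within distance 2 of some other neighbour of u or v.  The split is
-- then found greedily, first along edges and then along pairs at distance 2.  This
-- condition and the bound on |N(u) ∩ N[v]| are expressible in first-order logic with a
-- counting quantifier, and such a formula is evaluated by nested loops over the vertices,
-- that is, by a nested bounded sum, which compiles to a polynomial-time machine program.

module Submission where

open import Defs
open import Algebra.Properties.CommutativeSemigroup using (interchange)
open import Data.Bool using (Bool; true; false; T; _∧_; not; if_then_else_)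
import Data.Bool.Properties as Bool
open import Data.Bool.Properties using (T?; T-∧; not-involutive)
open import Data.Empty using (⊥; ⊥-elim)
open import Data.Fin using (Fin; zero; suc; toℕ; fromℕ; inject₁; _≟_)
import Data.Fin as Fin
import Data.Fin.Properties as Fin
open import Data.List using (List; []; _∷_; _++_; length; drop; map; last; filter; tabulate; allFin; cartesianProduct)
import Data.List.Membership.DecPropositional as DecMembership
open import Data.List.Membership.Propositional using (_∈_)
open import Data.List.Membership.Propositional.Properties using
  (∈-allFin; ∈-filter⁺; ∈-filter⁻; ∈-cartesianProduct⁺; ∈-map⁺; ∈-∃++; ∈-++⁺ˡ; ∈-++⁺ʳ; ∈-++⁻)
import Data.List.Properties as List
open import Data.List.Relation.Unary.All using ([]; _∷_)
import Data.List.Relation.Unary.All as All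
import Data.List.Relation.Unary.All.Properties as All
open import Data.List.Relation.Unary.AllPairs using ([]; _∷_)
open import Data.List.Relation.Unary.Any using (here; there)
open import Data.List.Relation.Unary.Linked using (Linked; [-]; _∷_)
open import Data.List.Relation.Unary.Unique.Propositional using (Unique)
import Data.List.Relation.Unary.Unique.Propositional.Properties as Unique
open import Data.Maybe using (Maybe; just; nothing; fromMaybe)
open import Data.Maybe.Properties using (just-injective)
open import Data.Nat using (ℕ; zero; suc; _+_; _*_; _∸_; _≤_; _<_; _≡ᵇ_; _≤?_; _<?_; z≤n; s≤s)
open import Data.Nat.Induction using (<-rec)
open import Data.Nat.Properties hiding (_≟_; _≤?_; _<?_)
open import Data.Product using (_×_; _,_; proj₁; proj₂; swap; ∃; ∃₂)
open import Data.Sum using (_⊎_; inj₁; inj₂; [_,_]′)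
open import Data.Unit using (tt)
open import Data.Vec using (Vec; []; _∷_; lookup; _∷ʳ_)
import Data.Vec as Vec
open import Data.Vec.Functional using (updateAt)
open import Data.Vec.Functional.Properties using (updateAt-updates; updateAt-minimal)
open import Function using (_∘_; id; _⇔_; mk⇔; Equivalence)
open import Relation.Binary using (Symmetric; tri<; tri≈; tri>) renaming (Decidable to Decidable₂)
open import Relation.Binary.PropositionalEquality using (_≡_; _≢_; refl; sym; trans; cong; cong₂; subst; module ≡-Reasoning)
open import Relation.Nullary using (yes; no; ¬_; Dec; ¬?; does; Reflects; ofʸ; ofⁿ)
open import Relation.Nullary.Decidable using (_×-dec_; _⊎-dec_; _→-dec_; decidable-stable; does-⇔)
open import Relation.Unary using (Decidable)

open Equivalence using (to; from)

-- Execution of code fragments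

-- Splitting the common neighbours looks like a constraint problem, but each vertex asks for just
-- one partner on the other side, and a graph without isolated vertices always has a 2-colouring in
-- which every vertex has a neighbour of the other colour. The obstacle is the part whose colour is
-- prescribed. A private neighbour of `u`, one that is neither equal nor adjacent to `v`, stays with
-- `u`, so its partner has to be forced to the side of `v`. If both `u` and `v` have private
-- neighbours, diameter 2 makes these partners of each other. Otherwise only one side has demands,
-- all for the same colour, so they cannot contradict each other. They can only contradict the inner
-- vertex `x` of the path that is to survive, and this conflict is avoided by rerouting that path
-- through a private neighbour.

record Reach (P : Program) (bound : ℕ) (c d : Config) : Set where
  constructor reach
  field
    time  : ℕ
    time≤ : time ≤ bound
    -- The time is exact and the remaining fuel `s` is arbitrary, so runs compose by adding times,
    -- without a monotonicity lemma for `run`; only `bound` is an estimate.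
    runs  : ∀ s → run P (time + s) c ≡ run P s d

record At (P : Program) (p : ℕ) (code : List Instr) : Set where
  constructor placed
  field
    rest    : List Instr
    dropped : drop p P ≡ code ++ rest

module _ {P : Program} where

  reach-trans : ∀ {a b c d e} → Reach P a c d → Reach P b d e → Reach P (a + b) c e
  reach-trans {a} {b} {c} (reach t t≤ r) (reach u u≤ q) =
    reach (t + u) (+-mono-≤ t≤ u≤)
      (λ s → trans (cong (λ z → run P z c) (+-assoc t u s)) (trans (r (u + s)) (q s)))

  reach-to : ∀ {b c p q r inp} → p ≡ q → Reach P b c (config p r inp) → Reach P b c (config q r inp)
  reach-to refl reached = reached

  reach-mono : ∀ {a b c d} → a ≤ b → Reach P a c d → Reach P b c d
  reach-mono a≤b (reach t t≤ r) = reach t (≤-trans t≤ a≤b) r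

  at-tail : ∀ {p i is} → At P p (i ∷ is) → At P (suc p) is
  at-tail {p} {i} {is} (placed rest eq) = placed rest (begin
    drop (suc p) P      ≡⟨ cong (λ q → drop q P) (+-comm 1 p) ⟩
    drop (p + 1) P      ≡⟨ sym (List.drop-drop p 1 P) ⟩
    drop 1 (drop p P)   ≡⟨ cong (drop 1) eq ⟩
    is ++ rest          ∎)
    where open ≡-Reasoning

  at-left : ∀ {p} is {js} → At P p (is ++ js) → At P p is
  at-left is {js} (placed rest eq) = placed (js ++ rest) (trans eq (List.++-assoc is js rest))

  at-right : ∀ {p} is {js} → At P p (is ++ js) → At P (length is + p) js
  at-right [] at = at
  at-right {p} (i ∷ is) {js} at = subst (λ q → At P q js) (+-suc (length is) p) (at-right is (at-tail at))

  instr : ∀ {p i is r inp d} → At P p (i ∷ is) → step i (config p r inp) ≡ inj₂ d →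
          Reach P 1 (config p r inp) d
  instr {p} {i} {is} {r} {inp} {d} (placed rest eq) st = reach 1 ≤-refl go
    where
    go : ∀ s → run P (1 + s) (config p r inp) ≡ run P s d
    go s rewrite eq | st = refl

  answered : ∀ {p b is r inp} t → At P p (answer b ∷ is) → run P (suc t) (config p r inp) ≡ just b
  answered t (placed rest eq) rewrite eq = refl

get-same : ∀ (r : ℕ → ℕ) i x → (r [ i ↦ x ]) i ≡ x
get-same r i x with i ≡ᵇ i in eq
... | true  = refl
... | false = ⊥-elim (subst T eq (≡⇒≡ᵇ i i refl))

get-other : ∀ (r : ℕ → ℕ) i x {j} → j ≢ i → (r [ i ↦ x ]) j ≡ r j
get-other r i x {j} j≢i with j ≡ᵇ i in eq
... | false = refl
... | true  = ⊥-elim (j≢i (≡ᵇ⇒≡ j i (subst T (sym eq) tt)))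

jump-taken : ∀ {x m} {a b : ℕ} → x ≡ suc m → (if x ≡ᵇ 0 then a else b) ≡ b
jump-taken refl = refl

jump-skipped : ∀ {x} {a b : ℕ} → x ≡ 0 → (if x ≡ᵇ 0 then a else b) ≡ a
jump-skipped refl = refl

-- Addition of polynomials given by their coefficients

infixl 6 _⊞_
_⊞_ : List ℕ → List ℕ → List ℕ
[]       ⊞ bs       = bs
(a ∷ as) ⊞ []       = a ∷ as
(a ∷ as) ⊞ (b ∷ bs) = a + b ∷ as ⊞ bs

eval-⊞ : ∀ as bs x → eval (as ⊞ bs) x ≡ eval as x + eval bs x
eval-⊞ []       bs       x = refl
eval-⊞ (a ∷ as) []       x = sym (+-identityʳ _)
eval-⊞ (a ∷ as) (b ∷ bs) x = begin
  (a + b) + x * eval (as ⊞ bs) x            ≡⟨ cong (λ z → (a + b) + x * z) (eval-⊞ as bs x) ⟩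
  (a + b) + x * (eval as x + eval bs x)     ≡⟨ cong ((a + b) +_) (*-distribˡ-+ x (eval as x) (eval bs x)) ⟩
  (a + b) + (x * eval as x + x * eval bs x) ≡⟨ interchange +-commutativeSemigroup a b _ _ ⟩
  (a + x * eval as x) + (b + x * eval bs x) ∎
  where open ≡-Reasoning

eval-const : ∀ a x → eval (a ∷ []) x ≡ a
eval-const a x = trans (cong (a +_) (*-zeroʳ x)) (+-identityʳ a)

-- The counter register c runs down to 0, so that the body sees its values in
-- decreasing order; t is a scratch register.
loop : (c t p : ℕ) → List Instr → List Instr
loop c t p body =
  const t 1 ∷ jump t (length body + (4 + p)) ∷
  const t 1 ∷ sub c c t ∷ (body ++ jump c (2 + p) ∷ [])

enter : (c t : ℕ) → (ℕ → ℕ) → (ℕ → ℕ)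
enter c t r = (r [ t ↦ 1 ]) [ c ↦ (r [ t ↦ 1 ]) c ∸ (r [ t ↦ 1 ]) t ]

module _ {P : Program} {c t p : ℕ} {body : List Instr} (at : At P p (loop c t p body))
  (Inv : ℕ → (ℕ → ℕ) → List ℕ → Set) (bound : ℕ)
  (counter : ∀ {m r inp} → Inv m r inp → r c ≡ m)
  (scratch : ∀ {m r inp} x → Inv m r inp → Inv m (r [ t ↦ x ]) inp)
  (iterate : ∀ {m r inp} → Inv (suc m) r inp →
     ∃₂ λ r′ inp′ → Reach P bound (config (4 + p) (enter c t r) inp) (config (length body + (4 + p)) r′ inp′)
                    × Inv m r′ inp′)
  where

  private
    test : ℕ
    test = length body + (4 + p)

    at-test : At P test (jump c (2 + p) ∷ [])
    at-test = at-right body (at-tail (at-tail (at-tail (at-tail at))))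

    from-test : ∀ m {r inp} → Inv m r inp →
      ∃₂ λ r′ inp′ → Reach P (1 + m * (3 + bound)) (config test r inp) (config (suc test) r′ inp′) × Inv 0 r′ inp′
    from-test zero {r} {inp} inv =
      r , inp , instr at-test (cong (λ z → inj₂ (config z r inp)) (jump-skipped (counter inv))) , inv
    from-test (suc m) {r} {inp} inv with iterate inv
    ... | r₁ , inp₁ , reach₁ , inv₁ with from-test m inv₁
    ... | r₂ , inp₂ , reach₂ , inv₂ = r₂ , inp₂ , reach-mono (≤-reflexive eq) all , inv₂
      where
      eq : 1 + (2 + (bound + (1 + m * (3 + bound)))) ≡ 1 + suc m * (3 + bound)
      eq = cong (λ z → 3 + z) (+-suc bound (m * (3 + bound)))
      all = reach-trans (instr at-test (cong (λ z → inj₂ (config z r inp)) (jump-taken (counter inv))))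
           (reach-trans (reach-trans (instr (at-tail (at-tail at)) refl)
                                     (instr (at-tail (at-tail (at-tail at))) refl))
           (reach-trans reach₁ reach₂))

  -- The constant 3 counts the two instructions before the first test and the last test, which
  -- fails. A round costs a successful test, two instructions that decrement the counter, and the
  -- body. Since the loop is entered at its test, `m` may be 0.
  loop-correct : ∀ m {r inp} → Inv m r inp →
    ∃₂ λ r′ inp′ → Reach P (3 + m * (3 + bound)) (config p r inp) (config (length (loop c t p body) + p) r′ inp′)
                   × Inv 0 r′ inp′
  loop-correct m {r} {inp} inv with from-test m (scratch 1 inv)
  ... | r′ , inp′ , reach′ , inv′ = r′ , inp′ , reach-to eq all , inv′
    where
    eq : suc test ≡ length (loop c t p body) + p
    eq = begin
      suc (length body + (4 + p))                     ≡⟨ cong suc (+-suc (length body) (3 + p)) ⟩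
      2 + (length body + (3 + p))                     ≡⟨ cong (2 +_) (+-suc (length body) (2 + p)) ⟩
      3 + (length body + (2 + p))                     ≡⟨ cong (3 +_) (+-suc (length body) (1 + p)) ⟩
      4 + (length body + (1 + p))                     ≡⟨ cong (4 +_) (sym (+-assoc (length body) 1 p)) ⟩
      4 + ((length body + 1) + p)                     ≡⟨ cong (λ z → 4 + (z + p)) (sym (List.length-++ body)) ⟩
      length (loop c t p body) + p                    ∎
      where open ≡-Reasoning
    all = reach-trans (instr at refl)
         (reach-trans (instr (at-tail at) (cong (λ z → inj₂ (config z _ inp)) (jump-taken (get-same r t 1)))) reach′)

-- Compiling bounded sums

-- De Bruijn variables; mem reads the array that starts at register base, and
-- ∑ i e sums e over the values below variable i.
infixl 6 _⊕_ _⊖_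
data Exp (m : ℕ) : Set where
  var     : Fin m → Exp m
  lit     : ℕ → Exp m
  _⊕_ _⊖_ : Exp m → Exp m → Exp m
  mem     : Exp m → Exp m
  ∑       : Fin m → Exp (suc m) → Exp m

sumBelow : ℕ → (ℕ → ℕ) → ℕ
sumBelow zero    f = 0
sumBelow (suc n) f = f n + sumBelow n f

value : ∀ {m} → (ℕ → ℕ) → Vec ℕ m → Exp m → ℕ
value M vs (var i)   = lookup vs i
value M vs (lit c)   = c
value M vs (e ⊕ f)   = value M vs e + value M vs f
value M vs (e ⊖ f)   = value M vs e ∸ value M vs f
value M vs (mem e)   = M (value M vs e)
value M vs (∑ i e)   = sumBelow (lookup vs i) (λ x → value M (x ∷ vs) e)

-- An upper bound on the number of registers used by the code.
height : ∀ {m} → Exp m → ℕ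
height (var i)   = 1
height (lit c)   = 1
height (e ⊕ f)   = height e + suc (height f)
height (e ⊖ f)   = height e + suc (height f)
height (mem e)   = height e + 2
height (∑ i e)   = 3 + height e

-- Coefficients of a polynomial bounding the running time.
cost : ∀ {m} → Exp m → List ℕ
cost (var i)   = 2 ∷ []
cost (lit c)   = 1 ∷ []
cost (e ⊕ f)   = cost e ⊞ cost f ⊞ (1 ∷ [])
cost (e ⊖ f)   = cost e ⊞ cost f ⊞ (1 ∷ [])
cost (mem e)   = cost e ⊞ (3 ∷ [])
cost (∑ i e)   = 5 ∷ ((4 ∷ []) ⊞ cost e)

module Compiler (base : ℕ) where

  -- ρ gives the registers of the variables, r receives the result, registers
  -- from r on may be overwritten, and p is the position of the code.
  compile : ∀ {m} → Vec ℕ m → (r p : ℕ) → Exp m → List Instr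
  compile ρ r p (var i) = const r 0 ∷ add r (lookup ρ i) r ∷ []
  compile ρ r p (lit c) = const r c ∷ []
  compile ρ r p (e ⊕ f) =
    let code = compile ρ r p e in
    code ++ compile ρ (suc r) (length code + p) f ++ add r r (suc r) ∷ []
  compile ρ r p (e ⊖ f) =
    let code = compile ρ r p e in
    code ++ compile ρ (suc r) (length code + p) f ++ sub r r (suc r) ∷ []
  compile ρ r p (mem e) =
    compile ρ r p e ++ const (suc r) base ∷ add r r (suc r) ∷ load r r ∷ []
  compile ρ r p (∑ i e) =
    const r 0 ∷ add (1 + r) (lookup ρ i) r ∷
    loop (1 + r) (2 + r) (2 + p)
      (compile (1 + r ∷ ρ) (2 + r) (6 + p) e ++ add r r (2 + r) ∷ [])

  -- Registers below `r` hold variables and pending results, those from `base` on hold the input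
  -- array; the window between them is the stack of the compiled code.
  Frame : ℕ → (ℕ → ℕ) → (ℕ → ℕ) → Set
  Frame r R R′ = ∀ j → j < r ⊎ base ≤ j → R′ j ≡ R j

  frame-trans : ∀ {r R R′ R″} → Frame r R R′ → Frame r R′ R″ → Frame r R R″
  frame-trans f g j o = trans (g j o) (f j o)

  frame-mono : ∀ {r r′ R R′} → r ≤ r′ → Frame r′ R R′ → Frame r R R′
  frame-mono r≤ f j (inj₁ j<r)  = f j (inj₁ (<-≤-trans j<r r≤))
  frame-mono r≤ f j (inj₂ b≤j)  = f j (inj₂ b≤j)

  frame-set : ∀ {r R} i x → r ≤ i → i < base → Frame r R (R [ i ↦ x ])
  frame-set {R = R} i x r≤i i<b j (inj₁ j<r) = get-other R i x (<⇒≢ (<-≤-trans j<r r≤i))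
  frame-set {R = R} i x r≤i i<b j (inj₂ b≤j) = get-other R i x (>⇒≢ (<-≤-trans i<b b≤j))

  module _ (P : Program) (N : ℕ) (M : ℕ → ℕ) where

    record Env {m} (ρ vs : Vec ℕ m) (r : ℕ) (R : ℕ → ℕ) : Set where
      field
        below  : ∀ i → lookup ρ i < r
        holds  : ∀ i → R (lookup ρ i) ≡ lookup vs i
        -- Only variables bound sums, so this is what turns `cost`, evaluated at `N`, into a bound
        -- on the running time.
        small  : ∀ i → lookup vs i ≤ N
        memory : ∀ j → R (base + j) ≡ M j

    open Env

    env-frame : ∀ {m} {ρ vs : Vec ℕ m} {r r′ R R′} → Env ρ vs r R → r ≤ r′ → Frame r R R′ → Env ρ vs r′ R′
    env-frame env r≤ f .below i  = <-≤-trans (below env i) r≤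
    env-frame env r≤ f .holds i  = trans (f _ (inj₁ (below env i))) (holds env i)
    env-frame env r≤ f .small i  = small env i
    env-frame env r≤ f .memory j = trans (f _ (inj₂ (m≤m+n base j))) (memory env j)

    record Outcome {m} (e : Exp m) (code : List Instr) (vs : Vec ℕ m) (r p : ℕ) (R : ℕ → ℕ) (inp : List ℕ) : Set where
      constructor outcome
      field
        regs′  : ℕ → ℕ
        reach′ : Reach P (eval (cost e) N) (config p R inp) (config (length code + p) regs′ inp)
        result : regs′ r ≡ value M vs e
        frame′ : Frame r R regs′

    private
      height-pos : ∀ {m} (e : Exp m) → 0 < height e
      height-pos (var i) = s≤s z≤n
      height-pos (lit c) = s≤s z≤n
      height-pos (e ⊕ f) = ≤-trans (height-pos e) (m≤m+n _ _)
      height-pos (e ⊖ f) = ≤-trans (height-pos e) (m≤m+n _ _)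
      height-pos (mem e) = ≤-trans (height-pos e) (m≤m+n _ _)
      height-pos (∑ i e) = s≤s z≤n

      fits-left : ∀ {a b c} → a + b + c ≤ base → a + c ≤ base
      fits-left {a} {b} {c} = ≤-trans (+-monoˡ-≤ c (m≤m+n a b))

      fits-right : ∀ {a b c} → a + suc b + c ≤ base → b + suc c ≤ base
      fits-right {a} {b} {c} = ≤-trans (≤-trans (≤-reflexive (+-suc b c)) (+-monoˡ-≤ c (m≤n+m (suc b) a)))

      fits-first : ∀ {m} (e : Exp m) {r} → height e + r ≤ base → r < base
      fits-first e {r} = ≤-trans (+-monoˡ-≤ r (height-pos e))

      position : ∀ (is js : List Instr) p → length js + (length is + p) ≡ length (is ++ js) + p
      position is js p = begin
        length js + (length is + p)   ≡⟨ sym (+-assoc (length js) _ p) ⟩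
        (length js + length is) + p   ≡⟨ cong (_+ p) (+-comm (length js) _) ⟩
        (length is + length js) + p   ≡⟨ cong (_+ p) (sym (List.length-++ is)) ⟩
        length (is ++ js) + p         ∎
        where open ≡-Reasoning

    Correct : ∀ {m} → Exp m → Set
    Correct {m} e = ∀ {ρ vs : Vec ℕ m} {r p R} inp → At P p (compile ρ r p e) →
      height e + r ≤ base → Env ρ vs r R → Outcome e (compile ρ r p e) vs r p R inp

    private
      binary : ∀ {m} (e f g : Exp m) → Correct e → Correct f → ∀ {ρ vs : Vec ℕ m} {r p R} inp
          (op : ℕ → ℕ → ℕ) (i : Instr) →
        let code = compile ρ r p e ; code′ = compile ρ (suc r) (length code + p) f ++ i ∷ [] in
        At P p (code ++ code′) → height e + suc (height f) + r ≤ base → Env ρ vs r R →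
        (∀ q R inp → step i (config q R inp) ≡ inj₂ (config (suc q) (R [ r ↦ op (R r) (R (suc r)) ]) inp)) →
        cost g ≡ cost e ⊞ cost f ⊞ (1 ∷ []) → value M vs g ≡ op (value M vs e) (value M vs f) →
        Outcome g (code ++ code′) vs r p R inp
      binary e f g correct-e correct-f {ρ} {vs} {r} {p} {R} inp op i at fits env st cg vg = go
        (correct-e inp (at-left code at) (fits-left {height e} fits) env)
        where
        code code₁ code₂ : List Instr
        code  = compile ρ r p e
        code₁ = compile ρ (suc r) (length code + p) f
        code₂ = code₁ ++ i ∷ []
        at₁ : At P (length code + p) code₂
        at₁ = at-right code at
        r<base : r < base
        r<base = fits-first e (fits-left {height e} fits)
        go : Outcome e code vs r p R inp → Outcome g (code ++ code₂) vs r p R inp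
        go (outcome R₁ reach₁ res₁ fr₁) with correct-f inp (at-left code₁ at₁) (fits-right {height e} {height f} fits)
                                                 (env-frame env (n≤1+n r) fr₁)
        ... | outcome R₂ reach₂ res₂ fr₂ =
          outcome _ (reach-to end
                    (reach-mono (≤-reflexive time) (reach-trans reach₁
                      (reach-trans reach₂ (instr (at-right code₁ at₁) (st _ R₂ inp))))))
            (trans (get-same R₂ r _) (trans (cong₂ op (trans (fr₂ r (inj₁ (n<1+n r))) res₁) res₂) (sym vg)))
            (frame-trans fr₁ (frame-trans (frame-mono (n≤1+n r) fr₂) (frame-set r _ ≤-refl r<base)))
          where
          end : suc (length code₁ + (length code + p)) ≡ length (code ++ code₂) + p
          end = trans (position code₁ (i ∷ []) (length code + p)) (position code code₂ p)
          time : eval (cost e) N + (eval (cost f) N + 1) ≡ eval (cost g) N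
          time = begin
            eval (cost e) N + (eval (cost f) N + 1)            ≡⟨ sym (+-assoc (eval (cost e) N) _ 1) ⟩
            eval (cost e) N + eval (cost f) N + 1              ≡⟨ cong₂ _+_ (sym (eval-⊞ (cost e) (cost f) N)) (sym (eval-const 1 N)) ⟩
            eval (cost e ⊞ cost f) N + eval (1 ∷ []) N         ≡⟨ sym (eval-⊞ (cost e ⊞ cost f) (1 ∷ []) N) ⟩
            eval (cost e ⊞ cost f ⊞ (1 ∷ [])) N                ≡⟨ cong (λ z → eval z N) (sym cg) ⟩
            eval (cost g) N                                    ∎
            where open ≡-Reasoning

    correct-var : ∀ {m} (i : Fin m) → Correct (var i)
    correct-var i {ρ} {vs} {r} {p} {R} inp at fits env =
      outcome _ (reach-mono (m≤m+n 2 (N * 0)) (reach-trans (instr at refl) (instr (at-tail at) refl)))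
        (trans (get-same R₁ r _) (trans
          (cong₂ _+_ (trans (get-other R r 0 (<⇒≢ (below env i))) (holds env i)) (get-same R r 0)) (+-identityʳ _)))
        (frame-trans (frame-set r 0 ≤-refl fits) (frame-set r _ ≤-refl fits))
      where
      R₁ : ℕ → ℕ
      R₁ = R [ r ↦ 0 ]

    correct-lit : ∀ {m} c → Correct {m} (lit c)
    correct-lit c {r = r} {R = R} inp at fits env =
      outcome _ (reach-mono (m≤m+n 1 (N * 0)) (instr at refl)) (get-same R r c) (frame-set r c ≤-refl fits)

    correct-mem : ∀ {m} (e : Exp m) → Correct e → Correct (mem e)
    correct-mem e correct-e {ρ} {vs} {r} {p} {R} inp at fits env
      with correct-e inp (at-left (compile ρ r p e) at) (fits-left {height e} fits) env
    ... | outcome R₁ reach₁ res₁ fr₁ =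
      outcome _ (reach-to (position code _ p)
                (reach-mono (≤-trans (+-monoʳ-≤ _ (m≤m+n 3 (N * 0))) (≤-reflexive (sym (eval-⊞ (cost e) (3 ∷ []) N))))
                  (reach-trans reach₁ (reach-trans (instr at₁ refl)
                    (reach-trans (instr (at-tail at₁) refl) (instr (at-tail (at-tail at₁)) refl))))))
        (trans (get-same R₃ r _) (trans (cong R₃ address)
          (trans (frame₃ _ (inj₂ (m≤m+n base _))) (trans (fr₁ _ (inj₂ (m≤m+n base _))) (memory env (value M vs e))))))
        (frame-trans fr₁ (frame-trans frame₃ (frame-set r _ ≤-refl r<base)))
      where
      code : List Instr
      code = compile ρ r p e
      at₁ : At P (length code + p) (const (suc r) base ∷ add r r (suc r) ∷ load r r ∷ [])
      at₁ = at-right code at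
      R₂ R₃ : ℕ → ℕ
      R₂ = R₁ [ suc r ↦ base ]
      R₃ = R₂ [ r ↦ R₂ r + R₂ (suc r) ]
      sr<base : suc r < base
      sr<base = ≤-trans (+-monoˡ-≤ r (m≤n+m 2 (height e))) fits
      r<base : r < base
      r<base = <-≤-trans (n<1+n r) (<⇒≤ sr<base)
      frame₃ : Frame r R₁ R₃
      frame₃ = frame-trans (frame-set (suc r) base (n≤1+n r) sr<base) (frame-set r _ ≤-refl r<base)
      address : R₃ r ≡ base + value M vs e
      address = begin
        R₃ r                      ≡⟨ get-same R₂ r _ ⟩
        R₂ r + R₂ (suc r)         ≡⟨ cong₂ _+_ (trans (get-other R₁ (suc r) base (<⇒≢ (n<1+n r))) res₁) (get-same R₁ (suc r) base) ⟩
        value M vs e + base       ≡⟨ +-comm _ base ⟩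
        base + value M vs e       ∎
        where open ≡-Reasoning

    record Summing (r : ℕ) (R : ℕ → ℕ) (inp : List ℕ) (f : ℕ → ℕ) (b m : ℕ) (Q : ℕ → ℕ) (inp′ : List ℕ) : Set where
      field
        count  : Q (1 + r) ≡ m
        small′ : m ≤ N
        -- `sumBelow` peels off its largest index and the counter runs down, so each round moves
        -- exactly the head of the outstanding sum into the accumulator.
        total  : Q r + sumBelow m f ≡ sumBelow b f
        kept   : Frame r R Q
        same   : inp′ ≡ inp

    open Summing

    correct-∑ : ∀ {m} i (e : Exp (suc m)) → Correct e → Correct (∑ i e)
    correct-∑ i e correct-e {ρ} {vs} {r} {p} {R} inp at fits env =
        finish (loop-correct at₂ Inv (eval (cost e) N + 1) counter scratch iterate b inv₀)
      where
      b : ℕ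
      b = lookup vs i
      f : ℕ → ℕ
      f x = value M (x ∷ vs) e
      code body : List Instr
      code = compile (1 + r ∷ ρ) (2 + r) (6 + p) e
      body = code ++ add r r (2 + r) ∷ []
      at₂ : At P (2 + p) (loop (1 + r) (2 + r) (2 + p) body)
      at₂ = at-tail (at-tail at)
      at-body : At P (6 + p) body
      at-body = at-left body (at-tail (at-tail (at-tail (at-tail at₂))))
      2+r<base : 2 + r < base
      2+r<base = ≤-trans (m≤n+m (3 + r) (height e))
          (≤-trans (≤-reflexive (trans (sym (+-assoc (height e) 3 r)) (cong (_+ r) (+-comm (height e) 3)))) fits)
      1+r<base : 1 + r < base
      1+r<base = <⇒≤ 2+r<base
      r<base : r < base
      r<base = <⇒≤ 1+r<base
      fits-body : height e + (2 + r) ≤ base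
      fits-body = ≤-trans (≤-trans (≤-reflexive
          (trans (sym (+-assoc (height e) 2 r)) (cong (_+ r) (+-comm (height e) 2)))) (n≤1+n _)) fits

      Inv : ℕ → (ℕ → ℕ) → List ℕ → Set
      Inv = Summing r R inp f b

      counter : ∀ {m Q inp} → Inv m Q inp → Q (1 + r) ≡ m
      counter = count

      scratch : ∀ {m Q inp} x → Inv m Q inp → Inv m (Q [ 2 + r ↦ x ]) inp
      scratch {m} {Q} x inv = record
        { count  = trans (get-other Q (2 + r) x (<⇒≢ (n<1+n (1 + r)))) (count inv)
        ; small′ = small′ inv
        ; total  = trans (cong (_+ sumBelow m f) (get-other Q (2 + r) x (<⇒≢ (m<n⇒m<1+n (n<1+n r))))) (total inv)
        ; kept   = frame-trans (kept inv) (frame-set (2 + r) x (≤-trans (n≤1+n r) (n≤1+n (1 + r))) 2+r<base)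
        ; same   = same inv }

      R₁ R₂ : ℕ → ℕ
      R₁ = R [ r ↦ 0 ]
      R₂ = R₁ [ 1 + r ↦ R₁ (lookup ρ i) + R₁ r ]

      inv₀ : Inv b R₂ inp
      inv₀ = record
        { count  = trans (get-same R₁ (1 + r) _)
            (trans (cong₂ _+_ (trans (get-other R r 0 (<⇒≢ (below env i))) (holds env i)) (get-same R r 0))
            (+-identityʳ _))
        ; small′ = small env i
        ; total  = cong (_+ sumBelow b f) (trans (get-other R₁ (1 + r) _ (<⇒≢ (n<1+n r))) (get-same R r 0))
        ; kept   = frame-trans (frame-set r 0 ≤-refl r<base) (frame-set (1 + r) _ (n≤1+n r) 1+r<base)
        ; same   = refl }

      iterate : ∀ {m Q inp′} → Inv (suc m) Q inp′ →
        ∃₂ λ Q′ inp″ → Reach P (eval (cost e) N + 1) (config (6 + p) (enter (1 + r) (2 + r) Q) inp′)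
            (config (length body + (6 + p)) Q′ inp″)
                    × Inv m Q′ inp″
      iterate {m} {Q} {inp′} inv = go (correct-e inp′ (at-left code at-body) fits-body env₂)
        where
        Q₁ Q₂ : ℕ → ℕ
        Q₁ = Q [ 2 + r ↦ 1 ]
        Q₂ = enter (1 + r) (2 + r) Q
        fr₂ : Frame r Q Q₂
        fr₂ = frame-trans (frame-set (2 + r) 1 (≤-trans (n≤1+n r) (n≤1+n (1 + r))) 2+r<base)
            (frame-set (1 + r) _ (n≤1+n r) 1+r<base)
        count₂ : Q₂ (1 + r) ≡ m
        count₂ = trans (get-same Q₁ (1 + r) _)
            (cong₂ _∸_ (trans (get-other Q (2 + r) 1 (<⇒≢ (n<1+n (1 + r)))) (count inv)) (get-same Q (2 + r) 1))
        acc₂ : Q₂ r ≡ Q r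
        acc₂ = trans (get-other Q₁ (1 + r) _ (<⇒≢ (n<1+n r))) (get-other Q (2 + r) 1 (<⇒≢ (m<n⇒m<1+n (n<1+n r))))
        outer : Env ρ vs r Q₂
        outer = env-frame env ≤-refl (frame-trans (kept inv) fr₂)
        env₂ : Env (1 + r ∷ ρ) (m ∷ vs) (2 + r) Q₂
        env₂ .below zero    = n<1+n (1 + r)
        env₂ .below (suc j) = m<n⇒m<1+n (m<n⇒m<1+n (below env j))
        env₂ .holds zero    = count₂
        env₂ .holds (suc j) = holds outer j
        env₂ .small zero    = ≤-trans (n≤1+n m) (small′ inv)
        env₂ .small (suc j) = small env j
        env₂ .memory j      = memory outer j
        go : Outcome e code (m ∷ vs) (2 + r) (6 + p) Q₂ inp′ → _
        go (outcome Q₃ reach₃ res₃ fr₃) =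
          Q₄ , inp′ , reach-to (position code (add r r (2 + r) ∷ []) (6 + p))
                        (reach-trans reach₃ (instr (at-right code at-body) refl)) , record
            { count  = trans (get-other Q₃ r _ (>⇒≢ (n<1+n r))) (trans (fr₃ _ (inj₁ (n<1+n (1 + r)))) count₂)
            ; small′ = ≤-trans (n≤1+n m) (small′ inv)
            ; total  = trans (cong (_+ sumBelow m f)
                (trans (get-same Q₃ r _) (cong₂ _+_ (trans (fr₃ r (inj₁ (m<n⇒m<1+n (n<1+n r)))) acc₂) res₃)))
                         (trans (+-assoc (Q r) _ _) (total inv))
            ; kept   = frame-trans (kept inv)
                (frame-trans fr₂ (frame-trans (frame-mono (≤-trans (n≤1+n r) (n≤1+n (1 + r))) fr₃)
                (frame-set r _ ≤-refl r<base)))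
            ; same   = same inv }
          where
          Q₄ : ℕ → ℕ
          Q₄ = Q₃ [ r ↦ Q₃ r + Q₃ (2 + r) ]

      finish : (∃₂ λ r′ inp′ → Reach P (3 + b * (3 + (eval (cost e) N + 1))) (config (2 + p) R₂ inp)
          (config (length (loop (1 + r) (2 + r) (2 + p) body) + (2 + p)) r′ inp′)
                   × Inv 0 r′ inp′) → Outcome (∑ i e) (compile ρ r p (∑ i e)) vs r p R inp
      finish (Q , inp′ , reach″ , inv) rewrite same inv =
        outcome Q (reach-to shift (reach-mono time
            (reach-trans (reach-trans (instr at refl) (instr (at-tail at) refl)) reach″)))
          (trans (sym (+-identityʳ (Q r))) (total inv)) (kept inv)
        where
        len = length (loop (1 + r) (2 + r) (2 + p) body)
        shift : len + (2 + p) ≡ 2 + len + p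
        shift = trans (sym (+-assoc len 2 p)) (cong (_+ p) (+-comm len 2))
        time : 5 + b * (3 + (eval (cost e) N + 1)) ≤ 5 + N * eval ((4 ∷ []) ⊞ cost e) N
        time = +-monoʳ-≤ 5 (≤-trans (*-monoˡ-≤ _ (small env i)) (≤-reflexive (cong (N *_) (begin
          3 + (eval (cost e) N + 1)        ≡⟨ cong (3 +_) (+-comm _ 1) ⟩
          4 + eval (cost e) N              ≡⟨ cong (_+ eval (cost e) N) (sym (eval-const 4 N)) ⟩
          eval (4 ∷ []) N + eval (cost e) N ≡⟨ sym (eval-⊞ (4 ∷ []) (cost e) N) ⟩
          eval ((4 ∷ []) ⊞ cost e) N       ∎))))
          where open ≡-Reasoning

    correct : ∀ {m} (e : Exp m) → Correct e
    correct (var i) = correct-var i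
    correct (lit c) = correct-lit c
    correct (e ⊕ f) inp at fits env = binary e f (e ⊕ f) (correct e) (correct f) inp _+_ (add _ _ _) at fits env
        (λ _ _ _ → refl) refl refl
    correct (e ⊖ f) inp at fits env = binary e f (e ⊖ f) (correct e) (correct f) inp _∸_ (sub _ _ _) at fits env
        (λ _ _ _ → refl) refl refl
    correct (mem e) = correct-mem e (correct e)
    correct (∑ i e) = correct-∑ i e (correct e)

-- Reading the input and deciding

-- The default 0 agrees with registers that were never written, so the memory from `base` on equals
-- `nth` of the input at every index.
nth : List ℕ → ℕ → ℕ
nth []       i       = 0
nth (x ∷ xs) zero    = x
nth (x ∷ xs) (suc i) = nth xs i

sum-const : ∀ n c → sumBelow n (λ _ → c) ≡ n * c
sum-const zero    c = refl
sum-const (suc n) c = cong (c +_) (sum-const n c)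

-- The budget and the n² matrix entries; abstract, lest type checking unfold the compiled code.
abstract
  cells : Exp 1
  cells = lit 1 ⊕ ∑ zero (var (suc zero))

  cells-value : ∀ M n → value M (n ∷ []) cells ≡ suc (n * n)
  cells-value M n = cong suc (sum-const n n)

module Decider (e : Exp 1) where

  -- The 4 keeps the array clear of registers 0 to 3, and the heights keep it clear of the stacks of
  -- both compiled expressions, which start at register 1.
  base : ℕ
  base = height cells + height e + 4

  open Compiler base

  -- Register 0 holds n, 1 counts the cells still to be read, 2 points to the next
  -- free cell, and 3 is scratch.
  read-cell : List Instr
  read-cell = read 3 ∷ store 2 3 ∷ const 3 1 ∷ add 2 2 3 ∷ []

  count-code read-code test-code : List Instr
  count-code = compile (0 ∷ []) 1 1 cells
  p₁ : ℕ
  p₁ = length count-code + 1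
  read-code = const 2 base ∷ loop 1 3 (1 + p₁) read-cell
  p₂ : ℕ
  p₂ = length (loop 1 3 (1 + p₁) read-cell) + (1 + p₁)
  test-code = compile (0 ∷ []) 1 p₂ e
  p₃ : ℕ
  p₃ = length test-code + p₂
  branch : List Instr
  branch = jump 1 (2 + p₃) ∷ answer false ∷ answer true ∷ []

  program : Program
  program = read 0 ∷ (count-code ++ read-code ++ test-code ++ branch)

  -- The linear coefficient 7 is the cost of a round of the reading loop: three control instructions
  -- and the four of `read-cell`. The constant 7 consists of the first `read`, the setting of the
  -- pointer, the 3 of the loop, and the final jump and answer.
  time-bound : List ℕ
  time-bound = (7 ∷ 7 ∷ []) ⊞ cost cells ⊞ cost e

  private
    at₀ : At program 0 program
    at₀ = placed [] (sym (List.++-identityʳ program))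
    at-count : At program 1 count-code
    at-count = at-left count-code (at-tail at₀)
    at-rest : At program p₁ (read-code ++ test-code ++ branch)
    at-rest = at-right count-code (at-tail at₀)
    at-read : At program p₁ read-code
    at-read = at-left read-code at-rest
    at-test-branch : At program p₂ (test-code ++ branch)
    at-test-branch = at-right (loop 1 3 (1 + p₁) read-cell) (at-tail at-rest)
    at-branch : At program p₃ branch
    at-branch = at-right test-code at-test-branch

    4≤base : 4 ≤ base
    4≤base = m≤n+m 4 (height cells + height e)

  record Reading (n : ℕ) (L : List ℕ) (m : ℕ) (R : ℕ → ℕ) (inp : List ℕ) : Set where
    field
      count   : R 1 ≡ m
      left    : length inp ≡ m
      done    : ℕ
      pointer : R 2 ≡ base + done
      order   : R 0 ≡ n
      written : ∀ i → i < done → R (base + i) ≡ nth L i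
      blank   : ∀ i → done ≤ i → R (base + i) ≡ 0
      coming  : ∀ i → nth inp i ≡ nth L (done + i)

  open Reading

  memory-low : ∀ {i j} → j < 4 → base + i ≢ j
  memory-low {i} j<4 = >⇒≢ (<-≤-trans j<4 (≤-trans 4≤base (m≤m+n base i)))

  read-iterate : ∀ {n L m R inp p} → At program (4 + p) read-cell → Reading n L (suc m) R inp →
    ∃₂ λ R′ inp′ → Reach program 4 (config (4 + p) (enter 1 3 R) inp) (config (8 + p) R′ inp′) × Reading n L m R′ inp′
  read-iterate {n} {L} {m} {R} {x ∷ inp} {p} at inv =
    R₆ , inp , reach-trans (instr at refl) (reach-trans (instr (at-tail at) refl)
        (reach-trans (instr (at-tail (at-tail at)) refl) (instr (at-tail (at-tail (at-tail at))) refl))) , record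
      { count   = trans (cong (λ z → (R₄ [ z ↦ x ]) 1) ptr)
          (trans (get-other R₄ (base + done inv) x (λ eq → memory-low {done inv} (s≤s (s≤s z≤n)) (sym eq)))
                  (cong (_∸ 1) (count inv)))
      ; left    = suc-injective (left inv)
      ; done    = suc (done inv)
      ; pointer = trans (cong₂ _+_ ptr₅ refl) (trans (+-comm _ 1) (sym (+-suc base (done inv))))
      ; order   = trans (cong (λ z → (R₄ [ z ↦ x ]) 0) ptr)
          (trans (get-other R₄ (base + done inv) x (λ eq → memory-low {done inv} (s≤s z≤n) (sym eq))) (order inv))
      ; written = written′
      ; blank   = λ i d<i → trans (high i (λ eq → <⇒≢ d<i (sym eq))) (blank inv i (<⇒≤ d<i))
      ; coming  = λ i → trans (coming inv (suc i)) (cong (nth L) (+-suc (done inv) i)) }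
    where
    R₁ R₃ R₄ R₅ R₆ : ℕ → ℕ
    R₁ = R [ 3 ↦ 1 ]
    R₃ = enter 1 3 R
    R₄ = R₃ [ 3 ↦ x ]
    R₅ = (R₄ [ R₄ 2 ↦ R₄ 3 ]) [ 3 ↦ 1 ]
    R₆ = R₅ [ 2 ↦ R₅ 2 + R₅ 3 ]
    ptr : R₄ 2 ≡ base + done inv
    ptr = pointer inv
    ptr₅ : R₅ 2 ≡ base + done inv
    ptr₅ = trans (cong (λ z → (R₄ [ z ↦ x ]) 2) ptr)
        (trans (get-other R₄ (base + done inv) x (λ eq → memory-low {done inv} (s≤s (s≤s (s≤s z≤n))) (sym eq)))
        (pointer inv))
    outside : ∀ i → R₆ (base + i) ≡ (R₄ [ base + done inv ↦ x ]) (base + i)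
    outside i = trans (get-other R₅ 2 (R₅ 2 + R₅ 3) (memory-low {i} (s≤s (s≤s (s≤s z≤n)))))
               (trans (get-other (R₄ [ R₄ 2 ↦ R₄ 3 ]) 3 1 (memory-low {i} (s≤s (s≤s (s≤s (s≤s z≤n))))))
                 (cong (λ z → (R₄ [ z ↦ x ]) (base + i)) ptr))
    high : ∀ i → i ≢ done inv → R₆ (base + i) ≡ R (base + i)
    high i i≢d = trans (outside i) (trans (get-other R₄ _ x (λ eq → i≢d (+-cancelˡ-≡ base i _ eq)))
                (trans (get-other R₃ 3 x (memory-low {i} (s≤s (s≤s (s≤s (s≤s z≤n))))))
                (trans (get-other R₁ 1 (R₁ 1 ∸ R₁ 3) (memory-low {i} (s≤s (s≤s z≤n))))
                  (get-other R 3 1 (memory-low {i} (s≤s (s≤s (s≤s (s≤s z≤n)))))))))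
    written′ : ∀ i → i < suc (done inv) → R₆ (base + i) ≡ nth L i
    written′ i (s≤s i≤d) with m≤n⇒m<n∨m≡n i≤d
    ... | inj₁ i<d  = trans (high i (<⇒≢ i<d)) (written inv i i<d)
    ... | inj₂ refl = trans (outside i)
        (trans (get-same R₄ (base + i) x) (trans (coming inv 0) (cong (nth L) (+-identityʳ i))))

  read-done : ∀ {n L R inp} → Reading n L 0 R inp → ∀ i → R (base + i) ≡ nth L i
  read-done {L = L} {inp = []} inv i with i <? done inv
  ... | yes i<d = written inv i i<d
  ... | no  i≮d = trans (blank inv i (≮⇒≥ i≮d))
      (trans (coming inv (i ∸ done inv)) (cong (nth L) (m+[n∸m]≡n (≮⇒≥ i≮d))))

  scratch : ∀ {n L m R inp} x → Reading n L m R inp → Reading n L m (R [ 3 ↦ x ]) inp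
  scratch {R = R} x inv = record
    { count = count inv ; left = left inv ; done = done inv ; pointer = pointer inv ; order = order inv
    ; written = λ i i<d → trans (get-other R 3 x (memory-low {i} (s≤s (s≤s (s≤s (s≤s z≤n)))))) (written inv i i<d)
    ; blank = λ i d≤i → trans (get-other R 3 x (memory-low {i} (s≤s (s≤s (s≤s (s≤s z≤n)))))) (blank inv i d≤i)
    ; coming = coming inv }

  module _ (N n : ℕ) (L : List ℕ) (len≡ : length L ≡ suc (n * n)) (cells≤ : suc (n * n) ≤ N) (n≤N : n ≤ N) where

    private
      C E K total : ℕ
      C = eval (cost cells) N
      E = eval (cost e) N
      K = suc (n * n) * 7
      total = (1 + C + 1 + (3 + K)) + E

    counted : ∃ λ R → Reach program (1 + C + 1) (initial (n ∷ L)) (config (1 + p₁) R L) × Reading n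
        L (suc (n * n)) R L
    counted = go (correct program N (λ _ → 0) cells L at-count fits env)
      where
      R₀ : ℕ → ℕ
      R₀ = (λ _ → 0) [ 0 ↦ n ]
      fits : height cells + 1 ≤ base
      fits = ≤-trans (+-monoʳ-≤ (height cells) (≤-trans (s≤s z≤n) (m≤n+m 4 (height e))))
          (≤-reflexive (sym (+-assoc (height cells) (height e) 4)))
      env : Env program N (λ _ → 0) (0 ∷ []) (n ∷ []) 1 R₀
      env = record { below = λ { zero → s≤s z≤n } ; holds = λ { zero → refl } ; small = λ { zero → n≤N }
                   ; memory = λ j → get-other (λ _ → 0) 0 n (memory-low {j} (s≤s z≤n)) }
      go : Outcome program N (λ _ → 0) cells count-code (n ∷ []) 1 1 R₀ L → _
      go (outcome R₁ reach₁ res₁ fr₁) = R₂ ,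
        reach-trans (reach-trans (instr at₀ refl) reach₁) (instr at-read refl) , record
        { count = trans res₁ (cells-value (λ _ → 0) n) ; left = len≡ ; done = 0 ; pointer = sym (+-identityʳ base)
        ; order = fr₁ 0 (inj₁ (s≤s z≤n)) ; written = λ i ()
        ; blank = λ i _ → trans (get-other R₁ 2 base (memory-low {i} (s≤s (s≤s (s≤s z≤n)))))
                         (trans (fr₁ (base + i) (inj₂ (m≤m+n base i)))
                           (get-other (λ _ → 0) 0 n (memory-low {i} (s≤s z≤n))))
        ; coming = λ i → refl }
        where
        R₂ : ℕ → ℕ
        R₂ = R₁ [ 2 ↦ base ]

    loaded : ∃₂ λ R inp → Reach program (1 + C + 1 + (3 + K)) (initial (n ∷ L)) (config p₂ R inp) ×
        Reading n L 0 R inp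
    loaded = go counted
      where
      go : (∃ λ R → Reach program (1 + C + 1) (initial (n ∷ L)) (config (1 + p₁) R L) × Reading n L
          (suc (n * n)) R L) → _
      go (R₁ , reach₁ , inv₁) =
        let R₂ , inp , reach₂ , inv₂ = loop-correct {body = read-cell} (at-tail at-read) (Reading n L) 4 count scratch
                                         (read-iterate (at-left read-cell
                                           (at-tail (at-tail (at-tail (at-tail (at-tail at-read))))))) (suc (n * n))
                                           inv₁
        in R₂ , inp , reach-trans reach₁ reach₂ , inv₂

    tested : ∃₂ λ R inp → Reach program total (initial (n ∷ L)) (config p₃ R inp) × R 1 ≡ value (nth L) (n ∷ []) e
    tested = go loaded
      where
      fits : height e + 1 ≤ base
      fits = ≤-trans (+-monoʳ-≤ (height e) (s≤s z≤n))
          (≤-trans (m≤n+m (height e + 4) (height cells)) (≤-reflexive (sym (+-assoc (height cells) (height e) 4))))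
      go : (∃₂ λ R inp → Reach program (1 + C + 1 + (3 + K)) (initial (n ∷ L)) (config p₂ R inp) ×
          Reading n L 0 R inp) → _
      go (R₁ , inp , reach₁ , inv₁) = finish
          (correct program N (nth L) e inp (at-left test-code at-test-branch) fits env)
        where
        env : Env program N (nth L) (0 ∷ []) (n ∷ []) 1 R₁
        env = record { below = λ { zero → s≤s z≤n } ; holds = λ { zero → order inv₁ } ; small = λ { zero → n≤N } ;
            memory = read-done inv₁ }
        finish : Outcome program N (nth L) e test-code (n ∷ []) 1 p₂ R₁ inp → _
        finish (outcome R₂ reach₂ res₂ _) = R₂ , inp , reach-trans reach₁ reach₂ , res₂

    private
      total≤ : total + 2 ≤ eval time-bound N
      total≤ = begin
        (1 + C + 1 + (3 + K)) + E + 2                ≤⟨ +-monoˡ-≤ 2 (+-monoˡ-≤ E (+-monoʳ-≤ (1 + C + 1) (+-monoʳ-≤ 3 K≤))) ⟩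
        (1 + C + 1 + (3 + S)) + E + 2                ≡⟨ cong (λ z → z + (3 + S) + E + 2) (+-comm (1 + C) 1) ⟩
        (2 + C + (3 + S)) + E + 2                    ≡⟨ cong (λ z → z + E + 2) (+-comm (2 + C) (3 + S)) ⟩
        (3 + S + (2 + C)) + E + 2                    ≡⟨ +-comm _ 2 ⟩
        2 + (3 + S + (2 + C) + E)                    ≡⟨ cong (λ z → 2 + (3 + z + E)) (trans (sym (+-assoc S 2 C)) (cong (_+ C) (+-comm S 2))) ⟩
        eval (7 ∷ 7 ∷ []) N + C + E                  ≡⟨ cong (_+ E) (sym (eval-⊞ (7 ∷ 7 ∷ []) (cost cells) N)) ⟩
        eval ((7 ∷ 7 ∷ []) ⊞ cost cells) N + E       ≡⟨ sym (eval-⊞ ((7 ∷ 7 ∷ []) ⊞ cost cells) (cost e) N) ⟩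
        eval time-bound N                            ∎
        where
        open ≤-Reasoning
        S : ℕ
        S = N * (7 + N * 0)
        K≤ : K ≤ S
        K≤ = *-mono-≤ cells≤ (m≤m+n 7 (N * 0))

      -- Fuel left over by a run that ends early is handed to the halting configuration, which
      -- answers with any positive amount of it.
      within : ∀ {c b d T} → Reach program c (initial (n ∷ L)) d →
          (∀ t → run program (suc t) d ≡ just b) → suc c ≤ T →
               run program T (initial (n ∷ L)) ≡ just b
      within {c} {b} {d} {T} (reach t t≤ r) ans c< = go (m≤n⇒∃[o]m+o≡n (≤-trans (s≤s t≤) c<))
        where
        go : (∃ λ o → suc t + o ≡ T) → run program T (initial (n ∷ L)) ≡ just b
        go (o , eq) = trans (cong (λ z → run program z (initial (n ∷ L))) (trans (sym eq) (sym (+-suc t o))))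
            (trans (r (suc o)) (ans o))

    decides : run program (eval time-bound N) (initial (n ∷ L)) ≡ just (not (value (nth L) (n ∷ []) e ≡ᵇ 0))
    decides = go tested
      where
      go : (∃₂ λ R inp → Reach program total (initial (n ∷ L)) (config p₃ R inp) × R 1 ≡ value (nth L) (n ∷ []) e) → _
      go (R , inp , reached , res) = conclude (value (nth L) (n ∷ []) e) res
        where
        conclude : ∀ v → R 1 ≡ v → run program (eval time-bound N) (initial (n ∷ L)) ≡ just (not (v ≡ᵇ 0))
        conclude zero eq =
          within (reach-trans reached (instr at-branch (cong (λ z → inj₂ (config z R inp)) (jump-skipped eq))))
            (λ t → answered t (at-tail at-branch)) (≤-trans (≤-reflexive (sym (+-suc total 1))) total≤)
        conclude (suc v) eq =
          within (reach-trans reached (instr at-branch (cong (λ z → inj₂ (config z R inp)) (jump-taken eq))))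
            (λ t → answered t (at-tail (at-tail at-branch))) (≤-trans (≤-reflexive (sym (+-suc total 1))) total≤)

-- First-order formulas with counting

-- `sumBelow` peels off the largest index, while `Fin` and `tabulate` peel off zero.
sum-shift : ∀ n f → sumBelow (suc n) f ≡ f 0 + sumBelow n (f ∘ suc)
sum-shift zero    f = refl
sum-shift (suc n) f = begin
  f (suc n) + sumBelow (suc n) f             ≡⟨ cong (f (suc n) +_) (sum-shift n f) ⟩
  f (suc n) + (f 0 + sumBelow n (f ∘ suc))   ≡⟨ sym (+-assoc (f (suc n)) (f 0) _) ⟩
  f (suc n) + f 0 + sumBelow n (f ∘ suc)     ≡⟨ cong (_+ sumBelow n (f ∘ suc)) (+-comm (f (suc n)) (f 0)) ⟩
  f 0 + f (suc n) + sumBelow n (f ∘ suc)     ≡⟨ +-assoc (f 0) (f (suc n)) _ ⟩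
  f 0 + sumBelow (suc n) (f ∘ suc)           ∎
  where open ≡-Reasoning

count-tabulate : ∀ {A : Set} {P : A → Set} (P? : Decidable P) n (g : Fin n → A) (f : ℕ → ℕ) →
  (∀ i → P (g i) → f (toℕ i) ≡ 1) → (∀ i → ¬ P (g i) → f (toℕ i) ≡ 0) →
  sumBelow n f ≡ length (filter P? (tabulate g))
count-tabulate P? zero    g f one none = refl
count-tabulate P? (suc n) g f one none with P? (g zero)
... | yes p = trans (sum-shift n f)
    (cong₂ _+_ (one zero p) (count-tabulate P? n (g ∘ suc) (f ∘ suc) (one ∘ suc) (none ∘ suc)))
... | no ¬p = trans (sum-shift n f)
    (cong₂ _+_ (none zero ¬p) (count-tabulate P? n (g ∘ suc) (f ∘ suc) (one ∘ suc) (none ∘ suc)))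

nth-left : ∀ xs ys {i} → i < length xs → nth (xs ++ ys) i ≡ nth xs i
nth-left (x ∷ xs) ys {zero}  i<     = refl
nth-left (x ∷ xs) ys {suc i} (s≤s i<) = nth-left xs ys i<

nth-right : ∀ xs ys i → nth (xs ++ ys) (length xs + i) ≡ nth ys i
nth-right []       ys i = refl
nth-right (x ∷ xs) ys i = nth-right xs ys i

nth-tabulate : ∀ {A : Set} n (g : Fin n → A) (h : A → ℕ) i → nth (map h (tabulate g)) (toℕ i) ≡ h (g i)
nth-tabulate (suc n) g h zero    = refl
nth-tabulate (suc n) g h (suc i) = nth-tabulate n (g ∘ suc) h i

nth-product : ∀ {A B : Set} m n (f : Fin m → A) (g : Fin n → B) (h : A × B → ℕ) i j →
  nth (map h (cartesianProduct (tabulate f) (tabulate g))) (toℕ i * n + toℕ j) ≡ h (f i , g j)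
nth-product (suc m) n f g h i j = trans (cong (λ zs → nth zs (toℕ i * n + toℕ j)) split) (go i)
  where
  row rest : List ℕ
  row  = map (λ y → h (f zero , y)) (tabulate g)
  rest = map h (cartesianProduct (tabulate (f ∘ suc)) (tabulate g))
  split : map h (cartesianProduct (tabulate f) (tabulate g)) ≡ row ++ rest
  split = trans (List.map-++ h (map (f zero ,_) (tabulate g)) _) (cong (_++ rest) (sym (List.map-∘ (tabulate g))))
  length-row : length row ≡ n
  length-row = trans (List.length-map _ (tabulate g)) (List.length-tabulate g)
  go : ∀ i → nth (row ++ rest) (toℕ i * n + toℕ j) ≡ h (f i , g j)
  go zero    = trans (nth-left row rest (subst (toℕ j <_) (sym length-row) (Fin.toℕ<n j)))
                     (nth-tabulate n g (λ y → h (f zero , y)) j)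
  go (suc i) = trans (cong (nth (row ++ rest))
      (trans (+-assoc n (toℕ i * n) (toℕ j)) (cong (_+ (toℕ i * n + toℕ j)) (sym length-row))))
              (trans (nth-right row rest (toℕ i * n + toℕ j)) (nth-product m n (f ∘ suc) g h i j))

infixr 6 _∧ᶠ_
infixr 5 _∨ᶠ_
infixr 4 _⇒ᶠ_
infix  7 ¬ᶠ_
data Formula (m : ℕ) : Set where
  adjᶠ eqᶠ          : Fin m → Fin m → Formula m
  _∧ᶠ_ _∨ᶠ_ _⇒ᶠ_     : Formula m → Formula m → Formula m
  ¬ᶠ_               : Formula m → Formula m
  ∀ᶠ ∃ᶠ few         : Formula (suc m) → Formula m

#_ : ∀ {n} {P : Fin n → Set} → Decidable P → ℕ
#_ {n} P? = length (filter P? (allFin n))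

module Semantics {n : ℕ} (G : Graph n) (k : ℕ) where

  Holds  : ∀ {m} → Vec (Fin n) m → Formula m → Set
  holds? : ∀ {m} (vs : Vec (Fin n) m) (φ : Formula m) → Dec (Holds vs φ)

  Holds vs (adjᶠ i j) = Adj G (lookup vs i) (lookup vs j)
  Holds vs (eqᶠ i j)  = lookup vs i ≡ lookup vs j
  Holds vs (φ ∧ᶠ ψ)  = Holds vs φ × Holds vs ψ
  Holds vs (φ ∨ᶠ ψ)  = Holds vs φ ⊎ Holds vs ψ
  Holds vs (φ ⇒ᶠ ψ)  = Holds vs φ → Holds vs ψ
  Holds vs (¬ᶠ φ)    = ¬ Holds vs φ
  Holds vs (∀ᶠ φ)    = ∀ x → Holds (x ∷ vs) φ
  Holds vs (∃ᶠ φ)    = ∃ λ x → Holds (x ∷ vs) φ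
  Holds vs (few φ)   = # (λ x → holds? (x ∷ vs) φ) ≤ k

  holds? vs (adjᶠ i j) = T? _
  holds? vs (eqᶠ i j)  = lookup vs i Fin.≟ lookup vs j
  holds? vs (φ ∧ᶠ ψ)  = holds? vs φ ×-dec holds? vs ψ
  holds? vs (φ ∨ᶠ ψ)  = holds? vs φ ⊎-dec holds? vs ψ
  holds? vs (φ ⇒ᶠ ψ)  = holds? vs φ →-dec holds? vs ψ
  holds? vs (¬ᶠ φ)    = ¬? (holds? vs φ)
  holds? vs (∀ᶠ φ)    = Fin.all? (λ x → holds? (x ∷ vs) φ)
  holds? vs (∃ᶠ φ)    = Fin.any? (λ x → holds? (x ∷ vs) φ)
  holds? vs (few φ)   = _ ≤? k

-- The variable of highest index holds the number of vertices.
vertices : ∀ m → Fin (suc m)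
vertices = fromℕ

negate : ∀ {m} → Exp m → Exp m
negate e = lit 1 ⊖ e

-- Any positive number counts as true, so disjunctions and existential quantifiers are plain sums
-- and negation is truncated subtraction from 1. Only `few` needs exact values: there the double
-- negation maps every positive number to 1. Cell 0 of the array is the budget and the matrix starts
-- at cell 1. The row offset is a sum of copies of the order, as expressions have no product.
truth : ∀ {m} → Formula m → Exp (suc m)
truth {m} (adjᶠ i j) = mem (lit 1 ⊕ (∑ (inject₁ i) (var (vertices (suc m))) ⊕ var (inject₁ j)))
truth (eqᶠ i j)  = negate ((var (inject₁ i) ⊖ var (inject₁ j)) ⊕ (var (inject₁ j) ⊖ var (inject₁ i)))
truth (φ ∧ᶠ ψ)  = negate (negate (truth φ) ⊕ negate (truth ψ))
truth (φ ∨ᶠ ψ)  = truth φ ⊕ truth ψ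
truth (φ ⇒ᶠ ψ)  = negate (truth φ) ⊕ truth ψ
truth (¬ᶠ φ)    = negate (truth φ)
truth (∀ᶠ φ)    = negate (∑ (vertices _) (negate (truth φ)))
truth (∃ᶠ φ)    = ∑ (vertices _) (truth φ)
truth (few φ)   = negate (∑ (vertices _) (negate (negate (truth φ))) ⊖ mem (lit 0))

adjacency : ∀ {n} → Graph n → Fin n × Fin n → ℕ
adjacency G (u , v) = if has G u v then 1 else 0

module _ {n : ℕ} (G : Graph n) (k : ℕ) where

  open Semantics G k

  -- The encoded instance without the order, which the program keeps in register 0.
  tape : List ℕ
  tape = k ∷ map (adjacency G) (cartesianProduct (allFin n) (allFin n))

  private
    env : ∀ {m} → Vec (Fin n) m → Vec ℕ (suc m)
    env vs = Vec.map toℕ vs ∷ʳ n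

    val : ∀ {m} → Vec (Fin n) m → Exp (suc m) → ℕ
    val vs = value (nth tape) (env vs)

    env-var : ∀ {m} (vs : Vec (Fin n) m) i → lookup (env vs) (inject₁ i) ≡ toℕ (lookup vs i)
    env-var (v ∷ vs) zero    = refl
    env-var (v ∷ vs) (suc i) = env-var vs i

    env-vertices : ∀ {m} (vs : Vec (Fin n) m) → lookup (env vs) (vertices m) ≡ n
    env-vertices []       = refl
    env-vertices (v ∷ vs) = env-vertices vs

    ∸-zero⇔ : ∀ x → 0 < 1 ∸ x ⇔ (¬ 0 < x)
    ∸-zero⇔ zero    = mk⇔ (λ _ ()) (λ _ → s≤s z≤n)
    ∸-zero⇔ (suc x) = mk⇔ (λ p → ⊥-elim (<-irrefl refl (subst (0 <_) (0∸n≡0 x) p))) (λ ¬0< → ⊥-elim (¬0< (s≤s z≤n)))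

    +-pos⇔ : ∀ x y → 0 < x + y ⇔ (0 < x ⊎ 0 < y)
    +-pos⇔ zero    y = mk⇔ inj₂ [ (λ ()) , id ]′
    +-pos⇔ (suc x) y = mk⇔ (λ _ → inj₁ (s≤s z≤n)) (λ _ → s≤s z≤n)

    sum-pos⁻ : ∀ n (f : ℕ → ℕ) → 0 < sumBelow n f → ∃ λ (i : Fin n) → 0 < f (toℕ i)
    sum-pos⁻ (suc n) f pos with to (+-pos⇔ (f 0) _) (subst (0 <_) (sum-shift n f) pos)
    ... | inj₁ p = zero , p
    ... | inj₂ p with sum-pos⁻ n (f ∘ suc) p
    ... | i , q = suc i , q

    sum-pos⁺ : ∀ n (f : ℕ → ℕ) (i : Fin n) → 0 < f (toℕ i) → 0 < sumBelow n f
    sum-pos⁺ (suc n) f zero    p = subst (0 <_) (sym (sum-shift n f)) (from (+-pos⇔ (f 0) _) (inj₁ p))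
    sum-pos⁺ (suc n) f (suc i) p = subst (0 <_) (sym (sum-shift n f))
        (from (+-pos⇔ (f 0) _) (inj₂ (sum-pos⁺ n (f ∘ suc) i p)))

    matrix : ∀ {m} (vs : Vec (Fin n) m) i j → val vs (truth (adjᶠ i j)) ≡ adjacency G (lookup vs i , lookup vs j)
    matrix {m} vs i j = begin
      nth row (sumBelow (lookup (env vs) (inject₁ i)) (λ x → lookup (x ∷ env vs) (vertices (suc m))) + lookup
          (env vs) (inject₁ j))
        ≡⟨ cong₂ (λ a b → nth row (a + b)) sum-row (env-var vs j) ⟩
      nth row (toℕ (lookup vs i) * n + toℕ (lookup vs j))
        ≡⟨ nth-product n n id id (adjacency G) (lookup vs i) (lookup vs j) ⟩
      adjacency G (lookup vs i , lookup vs j) ∎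
      where
      open ≡-Reasoning
      row : List ℕ
      row = map (adjacency G) (cartesianProduct (allFin n) (allFin n))
      sum-row : sumBelow (lookup (env vs) (inject₁ i)) (λ x → lookup (x ∷ env vs) (vertices (suc m))) ≡
          toℕ (lookup vs i) * n
      sum-row = trans (cong₂ (λ a b → sumBelow a (λ _ → b)) (env-var vs i) (env-vertices vs))
          (sum-const (toℕ (lookup vs i)) n)

  truth-correct : ∀ {m} (φ : Formula m) (vs : Vec (Fin n) m) → 0 < val vs (truth φ) ⇔ Holds vs φ
  truth-correct (adjᶠ i j) vs = subst (λ z → 0 < z ⇔ Adj G (lookup vs i) (lookup vs j)) (sym (matrix vs i j)) bit
    where
    bit : 0 < adjacency G (lookup vs i , lookup vs j) ⇔ Adj G (lookup vs i) (lookup vs j)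
    bit with has G (lookup vs i) (lookup vs j)
    ... | true  = mk⇔ (λ _ → tt) (λ _ → s≤s z≤n)
    ... | false = mk⇔ (λ ()) (λ ())
  truth-correct (eqᶠ i j) vs rewrite env-var vs i | env-var vs j = mk⇔ forth back
    where
    a b : ℕ
    a = toℕ (lookup vs i)
    b = toℕ (lookup vs j)
    forth : 0 < 1 ∸ ((a ∸ b) + (b ∸ a)) → lookup vs i ≡ lookup vs j
    forth p = Fin.toℕ-injective (≤-antisym (m∸n≡0⇒m≤n (m+n≡0⇒m≡0 (a ∸ b) zero-sum))
        (m∸n≡0⇒m≤n (m+n≡0⇒n≡0 (a ∸ b) zero-sum)))
      where
      zero-sum : (a ∸ b) + (b ∸ a) ≡ 0
      zero-sum = n≤0⇒n≡0 (≮⇒≥ (to (∸-zero⇔ _) p))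
    back : lookup vs i ≡ lookup vs j → 0 < 1 ∸ ((a ∸ b) + (b ∸ a))
    back e = subst (λ z → 0 < 1 ∸ ((a ∸ z) + (z ∸ a))) (cong toℕ e)
               (subst (λ z → 0 < 1 ∸ (z + z)) (sym (n∸n≡0 a)) (s≤s z≤n))
  truth-correct (φ ∧ᶠ ψ) vs = mk⇔ forth back
    where
    eφ : 0 < val vs (truth φ) ⇔ Holds vs φ
    eφ = truth-correct φ vs
    eψ : 0 < val vs (truth ψ) ⇔ Holds vs ψ
    eψ = truth-correct ψ vs
    x y : ℕ
    x = val vs (truth φ)
    y = val vs (truth ψ)
    forth : 0 < 1 ∸ ((1 ∸ x) + (1 ∸ y)) → Holds vs φ × Holds vs ψ
    forth p with holds? vs φ | holds? vs ψ
    ... | yes hφ | yes hψ = hφ , hψ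
    ... | no ¬φ  | _      = ⊥-elim (to (∸-zero⇔ ((1 ∸ x) + (1 ∸ y))) p
        (from (+-pos⇔ (1 ∸ x) _) (inj₁ (from (∸-zero⇔ x) (¬φ ∘ to eφ)))))
    ... | _      | no ¬ψ  = ⊥-elim (to (∸-zero⇔ ((1 ∸ x) + (1 ∸ y))) p
        (from (+-pos⇔ (1 ∸ x) _) (inj₂ (from (∸-zero⇔ y) (¬ψ ∘ to eψ)))))
    back : Holds vs φ × Holds vs ψ → 0 < 1 ∸ ((1 ∸ x) + (1 ∸ y))
    back (hφ , hψ) = from (∸-zero⇔ ((1 ∸ x) + (1 ∸ y)))
        (λ p → [ (λ q → to (∸-zero⇔ x) q (from eφ hφ)) , (λ q → to (∸-zero⇔ y) q (from eψ hψ)) ]′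
        (to (+-pos⇔ (1 ∸ x) _) p))
  truth-correct (φ ∨ᶠ ψ) vs = mk⇔
    (λ p → [ inj₁ ∘ to (truth-correct φ vs) , inj₂ ∘ to (truth-correct ψ vs) ]′ (to (+-pos⇔ (val vs (truth φ)) _) p))
    (λ h → from (+-pos⇔ (val vs (truth φ)) _)
      ([ inj₁ ∘ from (truth-correct φ vs) , inj₂ ∘ from (truth-correct ψ vs) ]′ h))
  truth-correct (φ ⇒ᶠ ψ) vs = mk⇔
    (λ p h → [ (λ q → ⊥-elim (to (∸-zero⇔ x) q (from eφ h))) , to eψ ]′ (to (+-pos⇔ (1 ∸ x) _) p))
    (back (holds? vs φ))
    where
    eφ : 0 < val vs (truth φ) ⇔ Holds vs φ
    eφ = truth-correct φ vs
    eψ : 0 < val vs (truth ψ) ⇔ Holds vs ψ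
    eψ = truth-correct ψ vs
    x : ℕ
    x = val vs (truth φ)
    back : Dec (Holds vs φ) → (Holds vs φ → Holds vs ψ) → 0 < (1 ∸ x) + val vs (truth ψ)
    back (yes hφ) h = from (+-pos⇔ (1 ∸ x) _) (inj₂ (from eψ (h hφ)))
    back (no ¬φ)  h = from (+-pos⇔ (1 ∸ x) _) (inj₁ (from (∸-zero⇔ x) (¬φ ∘ to eφ)))
  truth-correct (¬ᶠ φ) vs = mk⇔
    (λ p h → to (∸-zero⇔ _) p (from (truth-correct φ vs) h))
    (λ ¬h → from (∸-zero⇔ _) (¬h ∘ to (truth-correct φ vs)))
  truth-correct (∀ᶠ φ) vs rewrite env-vertices vs = mk⇔ forth back
    where
    f : ℕ → ℕ
    f x = value (nth tape) (x ∷ env vs) (truth φ)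
    forth : 0 < 1 ∸ sumBelow n (λ x → 1 ∸ f x) → ∀ x → Holds (x ∷ vs) φ
    forth p x with holds? (x ∷ vs) φ
    ... | yes h = h
    ... | no ¬h = ⊥-elim (to (∸-zero⇔ _) p (sum-pos⁺ n _ x (from (∸-zero⇔ _) (¬h ∘ to (truth-correct φ (x ∷ vs))))))
    back : (∀ x → Holds (x ∷ vs) φ) → 0 < 1 ∸ sumBelow n (λ x → 1 ∸ f x)
    back h = from (∸-zero⇔ _) λ p → let x , q = sum-pos⁻ n _ p in to (∸-zero⇔ _) q (from (truth-correct φ (x ∷ vs)) (h x))
  truth-correct (∃ᶠ φ) vs rewrite env-vertices vs = mk⇔
    (λ p → let x , q = sum-pos⁻ n _ p in x , to (truth-correct φ (x ∷ vs)) q)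
    (λ (x , h) → sum-pos⁺ n _ x (from (truth-correct φ (x ∷ vs)) h))
  truth-correct (few φ) vs rewrite env-vertices vs = mk⇔
    (λ p → subst (_≤ k) total (m∸n≡0⇒m≤n (n≤0⇒n≡0 (≮⇒≥ (to (∸-zero⇔ _) p)))))
    (λ c≤k → from (∸-zero⇔ _) (subst (λ z → ¬ 0 < z) (sym (m≤n⇒m∸n≡0 (subst (_≤ k) (sym total) c≤k))) (λ ())))
    where
    f : ℕ → ℕ
    f x = value (nth tape) (x ∷ env vs) (truth φ)
    one : ∀ z → 0 < z → 1 ∸ (1 ∸ z) ≡ 1
    one (suc z) _ = cong (1 ∸_) (0∸n≡0 z)
    none : ∀ z → ¬ 0 < z → 1 ∸ (1 ∸ z) ≡ 0
    none zero    _  = refl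
    none (suc z) ¬p = ⊥-elim (¬p (s≤s z≤n))
    total : sumBelow n (λ x → 1 ∸ (1 ∸ f x)) ≡ # (λ x → holds? (x ∷ vs) φ)
    total = count-tabulate (λ x → holds? (x ∷ vs) φ) n id _
      (λ i h → one _ (from (truth-correct φ (i ∷ vs)) h)) (λ i ¬h → none _ (¬h ∘ to (truth-correct φ (i ∷ vs))))

-- Distances

module _ {n : ℕ} (G : Graph n) where

  -- Walks that may pause stand in for paths of bounded length: no vertex has to be checked for
  -- repetition, and a search over midpoints decides them.
  Adj= Within2 Within3 : Fin n → Fin n → Set
  Adj= p q    = p ≡ q ⊎ Adj G p q
  Within2 p q = ∃ λ m → Adj= p m × Adj= m q
  Within3 p q = ∃ λ m → Adj= p m × Within2 m q

  -- Near u v p q: distance at most 2 in the graph without the vertices u and v.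
  Near : (u v p q : Fin n) → Set
  Near u v p q = ∃ λ m → (m ≢ u × m ≢ v) × Adj= p m × Adj= m q

  Private Common Flank Rest : (u v w : Fin n) → Set
  Private u v w = Adj G u w × ¬ Adj= v w
  Common u v w  = Adj G u w × Adj G v w
  Flank u v w   = (Adj G u w ⊎ Adj G v w) × w ≢ u × w ≢ v
  Rest u v w    = (w ≢ u × w ≢ v) × ¬ Adj G u w × ¬ Adj G v w

  -- x and y are the inner vertices of a shortest path u x y v that is to survive.
  Separable : (u v x y : Fin n) → Set
  Separable u v x y =
    (Adj G u x × x ≢ v) × (Adj G v y × y ≢ u) × Adj G x y ×
    (∀ a → Private u v a → ∃ λ z → (Adj G v z × z ≢ u) × z ≢ x × Near u v a z) ×
    (∀ b → Private v u b → ∃ λ z → (Adj G u z × z ≢ v) × z ≢ y × Near u v b z) ×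
    (∀ c → Common u v c → ∃ λ w → Flank u v w × w ≢ c × Near u v c w)

  adj-sym : ∀ {p q} → Adj G p q → Adj G q p
  adj-sym {p} {q} = subst T (symmetric G p q)

  adj-irrefl : ∀ {p} → ¬ Adj G p p
  adj-irrefl {p} = subst T (irreflexive G p)

  adj⇒≢ : ∀ {p q} → Adj G p q → p ≢ q
  adj⇒≢ p~q refl = adj-irrefl p~q

  adj=-sym : ∀ {p q} → Adj= p q → Adj= q p
  adj=-sym (inj₁ eq) = inj₁ (sym eq)
  adj=-sym (inj₂ e)  = inj₂ (adj-sym e)

  adj=⇒adj : ∀ {p q} → p ≢ q → Adj= p q → Adj G p q
  adj=⇒adj p≢q (inj₁ eq) = ⊥-elim (p≢q eq)
  adj=⇒adj p≢q (inj₂ e)  = e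

  within2-sym : ∀ {p q} → Within2 p q → Within2 q p
  within2-sym (m , a , b) = m , adj=-sym b , adj=-sym a

  within3-sym : ∀ {p q} → Within3 p q → Within3 q p
  within3-sym (m , a , m′ , b , c) = m′ , adj=-sym c , m , adj=-sym b , adj=-sym a

  within2⇒3 : ∀ {p q} → Within2 p q → Within3 p q
  within2⇒3 {p} w = p , inj₁ refl , w

  near-sym : ∀ {u v p q} → Near u v p q → Near u v q p
  near-sym (m , out , a , b) = m , out , adj=-sym b , adj=-sym a

  near-swap : ∀ {u v p q} → Near u v p q → Near v u p q
  near-swap (m , (m≢u , m≢v) , a , b) = m , (m≢v , m≢u) , a , b

  near-adj : ∀ {u v p q} → p ≢ u → p ≢ v → Adj G p q → Near u v p q
  near-adj {p = p} p≢u p≢v e = p , (p≢u , p≢v) , inj₁ refl , inj₂ e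

  flank-swap : ∀ {u v w} → Flank u v w → Flank v u w
  flank-swap (inj₁ e , a , b) = inj₂ e , b , a
  flank-swap (inj₂ e , a , b) = inj₁ e , b , a

  adj? : Decidable₂ (Adj G)
  adj? p q = T? (has G p q)

  adj=? : Decidable₂ Adj=
  adj=? p q = p ≟ q ⊎-dec adj? p q

  within2? : Decidable₂ Within2
  within2? p q = Fin.any? (λ m → adj=? p m ×-dec adj=? m q)

  within3? : Decidable₂ Within3
  within3? p q = Fin.any? (λ m → adj=? p m ×-dec within2? m q)

  near? : ∀ u v → Decidable₂ (Near u v)
  near? u v p q = Fin.any? (λ m → (¬? (m ≟ u) ×-dec ¬? (m ≟ v)) ×-dec adj=? p m ×-dec adj=? m q)

  private? : ∀ u v → Decidable (Private u v)
  private? u v w = adj? u w ×-dec ¬? (adj=? v w)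

  common? : ∀ u v → Decidable (Common u v)
  common? u v w = adj? u w ×-dec adj? v w

  flank? : ∀ u v → Decidable (Flank u v)
  flank? u v w = (adj? u w ⊎-dec adj? v w) ×-dec ¬? (w ≟ u) ×-dec ¬? (w ≟ v)

  rest? : ∀ u v → Decidable (Rest u v)
  rest? u v w = (¬? (w ≟ u) ×-dec ¬? (w ≟ v)) ×-dec ¬? (adj? u w) ×-dec ¬? (adj? v w)

  path-drop : ∀ {u v w ws} → u ∈ w ∷ ws → Linked (Adj G) (w ∷ ws) → Unique (w ∷ ws) → last (w ∷ ws) ≡ just v →
              ∃ λ ℓ → ℓ ≤ length ws × Path G u v ℓ
  path-drop {ws = ws} (here refl) l q e = length ws , ≤-refl , ws , l , q , e , refl
  path-drop {ws = w′ ∷ ws} (there i) (_ ∷ l) (_ ∷ q) e with path-drop i l q e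
  ... | ℓ , ℓ≤ , path = ℓ , m≤n⇒m≤1+n ℓ≤ , path

  -- A `Path` must not repeat a vertex; if `u` already lies on it, the suffix from `u` is taken
  -- instead.
  path-extend : ∀ {u w v ℓ} → Adj= u w → Path G w v ℓ → ∃ λ ℓ′ → ℓ′ ≤ suc ℓ × Path G u v ℓ′
  path-extend {ℓ = ℓ} (inj₁ refl) path = ℓ , n≤1+n ℓ , path
  path-extend {u} {w} {ℓ = ℓ} (inj₂ e) (ws , l , q , z , refl) with DecMembership._∈?_ _≟_ u (w ∷ ws)
  ... | yes u∈ with path-drop u∈ l q z
  ...   | ℓ′ , ℓ′≤ , path = ℓ′ , m≤n⇒m≤1+n ℓ′≤ , path
  path-extend {u} {w} {ℓ = ℓ} (inj₂ e) (ws , l , q , z , refl) | no u∉ =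
    suc ℓ , ≤-refl , w ∷ ws , e ∷ l , All.¬Any⇒All¬ (w ∷ ws) u∉ ∷ q , z , refl

  path-end : ∀ {v} → Path G v v 0
  path-end = [] , [-] , [] ∷ [] , refl , refl

  within2⇒path : ∀ {p q} → Within2 p q → ∃ λ ℓ → ℓ ≤ 2 × Path G p q ℓ
  within2⇒path (m , a , b) =
    let ℓ₁ , ℓ₁≤ , path₁ = path-extend b path-end
        ℓ₂ , ℓ₂≤ , path₂ = path-extend a path₁
    in ℓ₂ , ≤-trans ℓ₂≤ (s≤s ℓ₁≤) , path₂

  within3⇒path : ∀ {p q} → Within3 p q → ∃ λ ℓ → ℓ ≤ 3 × Path G p q ℓ
  within3⇒path (m , a , w) =
    let ℓ₁ , ℓ₁≤ , path₁ = within2⇒path w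
        ℓ₂ , ℓ₂≤ , path₂ = path-extend a path₁
    in ℓ₂ , ≤-trans ℓ₂≤ (s≤s ℓ₁≤) , path₂

  path⇒within2 : ∀ {p q ℓ} → ℓ ≤ 2 → Path G p q ℓ → Within2 p q
  path⇒within2 _ ([] , _ , _ , refl , refl) = _ , inj₁ refl , inj₁ refl
  path⇒within2 _ (a ∷ [] , e ∷ _ , _ , refl , refl) = _ , inj₂ e , inj₁ refl
  path⇒within2 _ (a ∷ b ∷ [] , e ∷ e′ ∷ _ , _ , refl , refl) = _ , inj₂ e , inj₂ e′
  path⇒within2 (s≤s (s≤s ())) (a ∷ b ∷ c ∷ ws , _ , _ , _ , refl)

  path⇒within3 : ∀ {p q ℓ} → ℓ ≤ 3 → Path G p q ℓ → Within3 p q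
  path⇒within3 _ ([] , _ , _ , refl , refl) = within2⇒3 (_ , inj₁ refl , inj₁ refl)
  path⇒within3 (s≤s ℓ≤) (a ∷ ws , e ∷ l , _ ∷ u , z , refl) = a , inj₂ e , path⇒within2 ℓ≤ (ws , l , u , z , refl)

  -- `IsDiam` bounds shortest paths only, so a shortest path must be produced from an arbitrary one.
  -- Strong induction on the length does this under a double negation, which the decidability of
  -- `Within3` removes.
  connected-diam3⇒within3 : Connected G → IsDiam G 3 → ∀ p q → Within3 p q
  connected-diam3⇒within3 (_ , paths) (_ , bounded) p q = decidable-stable (within3? p q) λ far →
    let absurd = <-rec (λ ℓ → ¬ Path G p q ℓ) λ ℓ shorter path →
          far (path⇒within3 (bounded p q ℓ
              (path , λ m path′ → decidable-stable (ℓ ≤? m) (λ ℓ≰m → shorter (≰⇒> ℓ≰m) path′))) path)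
    in absurd (proj₁ (paths p q)) (proj₂ (paths p q))

  diam3⇒¬within2 : IsDiam G 3 → ∃₂ λ u v → ¬ Within2 u v
  diam3⇒¬within2 ((u , v , _ , least) , _) = u , v , λ w →
    let ℓ , ℓ≤2 , path = within2⇒path w in <⇒≱ (s≤s ℓ≤2) (least ℓ path)

  within3⇒connected-diam3 : ∀ {u v} → (∀ p q → Within3 p q) → ¬ Within2 u v → Connected G × IsDiam G 3
  within3⇒connected-diam3 {u} {v} all far =
    (nonempty u , λ p q → let ℓ , _ , path = within3⇒path (all p q) in ℓ , path) ,
    (u , v , subst (Path G u v) exact path₀ , atLeast) ,
    λ p q ℓ (_ , least) → let ℓ′ , ℓ′≤ , path = within3⇒path (all p q) in ≤-trans (least ℓ′ path) ℓ′≤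
    where
    nonempty : ∀ {n} → Fin n → 0 < n
    nonempty zero    = s≤s z≤n
    nonempty (suc _) = s≤s z≤n
    atLeast : ∀ m → Path G u v m → 3 ≤ m
    atLeast m path = decidable-stable (3 ≤? m) λ { 3≰m → far (path⇒within2 (≤-pred (≰⇒> 3≰m)) path) }
    path₀ : Path G u v (proj₁ (within3⇒path (all u v)))
    path₀ = proj₂ (proj₂ (within3⇒path (all u v)))
    exact : proj₁ (within3⇒path (all u v)) ≡ 3
    exact = ≤-antisym (proj₁ (proj₂ (within3⇒path (all u v)))) (atLeast _ path₀)

module _ {n : ℕ} {G H : Graph n} (H⊆G : ∀ p q → Adj H p q → Adj G p q) where

  adj=-mono : ∀ {p q} → Adj= H p q → Adj= G p q
  adj=-mono (inj₁ eq) = inj₁ eq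
  adj=-mono (inj₂ e)  = inj₂ (H⊆G _ _ e)

  within2-mono : ∀ {p q} → Within2 H p q → Within2 G p q
  within2-mono (m , a , b) = m , adj=-mono a , adj=-mono b

  within3-mono : ∀ {p q} → Within3 H p q → Within3 G p q
  within3-mono (m , a , w) = m , adj=-mono a , within2-mono w

-- Necessity of separability

module _ {n : ℕ} (G H : Graph n) (H⊆G : ∀ {p q} → Adj H p q → Adj G p q) (all : ∀ p q → Within3 H p q) where

  private
    ⊆= : ∀ {p q} → Adj= H p q → Adj= G p q
    ⊆= = adj=-mono {G = G} {H} (λ p q → H⊆G {p} {q})

  far⇒≢ : ∀ {u v} → ¬ Within2 H u v → u ≢ v
  far⇒≢ {u} far refl = far (u , inj₁ refl , inj₁ refl)

  far⇒¬adj : ∀ {u v} → ¬ Within2 H u v → ¬ Adj H u v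
  far⇒¬adj far e = far (_ , inj₂ e , inj₁ refl)

  ¬common : ∀ {u v w} → ¬ Within2 H u v → Adj H u w → ¬ Adj H v w
  ¬common far e e′ = far (_ , inj₂ e , inj₂ (adj-sym H e′))

  -- `z` is the last vertex before `v` on a walk of at most three edges from `w` in `H`. The part
  -- from `w` to `z` has at most two edges. It avoids `u`, which would otherwise be within distance
  -- 2 of `v`, and it avoids `v`, which is not adjacent to `w`.
  approach : ∀ {u v w} → ¬ Within2 H u v → w ≢ u → w ≢ v → ¬ Adj H v w → ∃ λ z → Adj H v z × z ≢ u × z
      ≢ w × Near G u v w z
  approach {u} {v} {w} far w≢u w≢v v≁w with all w v
  ... | p , w-p , q , p-q , q-v with q ≟ v
  ...   | yes refl with p ≟ v
  ...     | yes refl = ⊥-elim (v≁w (adj-sym H (adj=⇒adj H w≢v w-p)))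
  ...     | no p≢v   = p , adj-sym H (adj=⇒adj H p≢v p-q)
                     , (λ { refl → far⇒¬adj far (adj=⇒adj H p≢v p-q) })
                     , (λ { refl → v≁w (adj-sym H (adj=⇒adj H p≢v p-q)) })
                     , w , (w≢u , w≢v) , inj₁ refl , ⊆= w-p
  approach {u} {v} {w} far w≢u w≢v v≁w | p , w-p , q , p-q , q-v | no q≢v =
    q , v~q , (λ { refl → far⇒¬adj far (adj-sym H v~q) }) , (λ { refl → v≁w v~q })
      , p , (p≢u , p≢v) , ⊆= w-p , ⊆= p-q
    where
    v~q : Adj H v q
    v~q = adj-sym H (adj=⇒adj H q≢v q-v)
    p≢u : p ≢ u
    p≢u refl = far (q , p-q , inj₂ (adj-sym H v~q))
    p≢v : p ≢ v
    p≢v refl = v≁w (adj-sym H (adj=⇒adj H w≢v w-p))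

  -- `x` and `y` are read off a walk from `u` to `v` in `H`. A vertex `z` supplied by `approach` is
  -- a neighbour of `v` in `H`, hence differs from `x`, which is one of `u`: no vertex is both. A
  -- common neighbour in `G` has lost its edge to `u` or to `v`, and `approach` is applied towards
  -- the end that it lost.
  separable : ∀ {u v} → ¬ Within2 H u v → ∃₂ λ x y → Separable G u v x y
  separable {u} {v} far with all u v
  ... | x , u-x , y , x-y , y-v =
    x , y , (H⊆G u~x , x≢v) , (H⊆G v~y , y≢u) , H⊆G x~y , at-private-u , at-private-v , at-common
    where
    x≢u : x ≢ u
    x≢u refl = far (y , x-y , y-v)
    y≢v : y ≢ v
    y≢v refl = far (x , u-x , x-y)
    u~x : Adj H u x
    u~x = adj=⇒adj H (x≢u ∘ sym) u-x
    v~y : Adj H v y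
    v~y = adj-sym H (adj=⇒adj H y≢v y-v)
    x~y : Adj H x y
    x~y = adj=⇒adj H (λ { refl → ¬common far u~x v~y }) x-y
    x≢v : x ≢ v
    x≢v refl = far (v , u-x , inj₁ refl)
    y≢u : y ≢ u
    y≢u refl = far (u , inj₁ refl , y-v)
    at-private-u : ∀ a → Private G u v a → ∃ λ z → (Adj G v z × z ≢ u) × z ≢ x × Near G u v a z
    at-private-u a (u~a , v≁a) =
      let z , v~z , z≢u , _ , near = approach far (adj⇒≢ G u~a ∘ sym) (λ { refl → v≁a (inj₁ refl) }) (λ e → v≁a (inj₂ (H⊆G e)))
      in z , (H⊆G v~z , z≢u) , (λ z≡x → ¬common far u~x (subst (Adj H v) z≡x v~z)) , near
    at-private-v : ∀ b → Private G v u b → ∃ λ z → (Adj G u z × z ≢ v) × z ≢ y × Near G u v b z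
    at-private-v b (v~b , u≁b) =
      let z , u~z , z≢v , _ , near = approach (far ∘ within2-sym H) (adj⇒≢ G v~b ∘ sym) (λ { refl → u≁b (inj₁ refl) }) (λ e → u≁b (inj₂ (H⊆G e)))
      in z , (H⊆G u~z , z≢v) , (λ z≡y → ¬common far (subst (Adj H u) z≡y u~z) v~y) , near-swap G near
    at-common : ∀ c → Common G u v c → ∃ λ w → Flank G u v w × w ≢ c × Near G u v c w
    at-common c (u~c , v~c) with adj? H v c
    ... | no v≁c =
      let z , v~z , z≢u , z≢c , near = approach far (adj⇒≢ G u~c ∘ sym) (adj⇒≢ G v~c ∘ sym) v≁c
      in z , (inj₂ (H⊆G v~z) , z≢u , adj⇒≢ H v~z ∘ sym) , z≢c , near
    ... | yes v~′c =
      let z , u~z , z≢v , z≢c , near = approach (far ∘ within2-sym H) (adj⇒≢ G v~c ∘ sym) (adj⇒≢ G u~c ∘ sym) (λ u~′c → ¬common far u~′c v~′c)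
      in z , (inj₁ (H⊆G u~z) , adj⇒≢ H u~z ∘ sym , z≢v) , z≢c , near-swap G near

-- Colourings

true≢false : true ≢ false
true≢false ()

just≢nothing : ∀ {b : Bool} → just b ≢ nothing
just≢nothing ()

Colouring : ℕ → Set
Colouring n = Fin n → Maybe Bool

module _ {n} {E : Fin n → Fin n → Set} (E? : Decidable₂ E) (E-sym : Symmetric E) (E-irrefl : ∀ {w} → ¬ E w w) where

  record Extension (κ κ′ : Colouring n) : Set where
    field
      keeps   : ∀ {w b} → κ w ≡ just b → κ′ w ≡ just b
      -- The partner's colour is read in `κ′`, where `keeps` protects it, so a partner found once
      -- survives all later extensions.
      opposed : ∀ {w b} → κ′ w ≡ just b → κ w ≡ just b ⊎ ∃ λ z → E w z × κ′ z ≡ just (not b)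

  open Extension

  private
    extension-refl : ∀ {κ} → Extension κ κ
    extension-refl = record { keeps = id ; opposed = inj₁ }

    extension-trans : ∀ {κ κ′ κ″} → Extension κ κ′ → Extension κ′ κ″ → Extension κ κ″
    extension-trans {κ} {κ′} {κ″} e e′ = record { keeps = keeps e′ ∘ keeps e ; opposed = step′ }
      where
      step′ : ∀ {w b} → κ″ w ≡ just b → κ w ≡ just b ⊎ ∃ λ z → E w z × κ″ z ≡ just (not b)
      step′ eq with opposed e′ eq
      ... | inj₂ found = inj₂ found
      ... | inj₁ eq′ with opposed e eq′
      ...   | inj₁ eq″ = inj₁ eq″
      ...   | inj₂ (z , w-z , eq″) = inj₂ (z , w-z , keeps e′ eq″)

    paint : Colouring n → Fin n → Bool → Colouring n
    paint κ w b = updateAt κ w (λ _ → just b)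

    painted : ∀ κ w {b} → paint κ w b w ≡ just b
    painted κ w = updateAt-updates w κ

    unpainted : ∀ κ w {b z} → z ≢ w → paint κ w b z ≡ κ z
    unpainted κ w {z = z} z≢w = updateAt-minimal z w κ z≢w

    paint-opposite : ∀ {κ w z b} → κ w ≡ nothing → κ z ≡ just b → E w z → Extension κ (paint κ w (not b))
    paint-opposite {κ} {w} {z} {b} w-none z-b w-z = record { keeps = keeps′ ; opposed = opposed′ }
      where
      κ′ : Colouring n
      κ′ = paint κ w (not b)
      keeps′ : ∀ {t c} → κ t ≡ just c → κ′ t ≡ just c
      keeps′ {t} eq = trans (unpainted κ w (λ { refl → just≢nothing (trans (sym eq) w-none) })) eq
      opposed′ : ∀ {t c} → κ′ t ≡ just c → κ t ≡ just c ⊎ ∃ λ s → E t s × κ′ s ≡ just (not c)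
      opposed′ {t} {c} eq with t ≟ w
      ... | no t≢w   = inj₁ (trans (sym (unpainted κ w t≢w)) eq)
      ... | yes refl = inj₂ (z , w-z , trans (keeps′ z-b)
          (cong just (trans (sym (not-involutive b)) (cong not (just-injective (trans (sym (painted κ w)) eq))))))

    visit : ∀ κ w → ∃ λ κ′ → Extension κ κ′ × (κ′ w ≡ nothing → ∀ z → ¬ E w z)
    visit κ w with κ w in w-eq | Fin.any? (E? w)
    ... | just b  | _      = κ , extension-refl , λ eq → ⊥-elim (just≢nothing (trans (sym w-eq) eq))
    ... | nothing | no ¬z  = κ , extension-refl , λ _ z w-z → ¬z (z , w-z)
    ... | nothing | yes (z , w-z) with κ z in z-eq
    ...   | just b  = paint κ w (not b) , paint-opposite w-eq z-eq w-z , λ eq → ⊥-elim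
        (just≢nothing (trans (sym (painted κ w)) eq))
    ...   | nothing = κ₂ , record { keeps = keeps″ ; opposed = opposed″ } , λ eq → ⊥-elim
        (just≢nothing (trans (sym w-true) eq))
      where
      κ₁ κ₂ : Colouring n
      κ₁ = paint κ w true
      κ₂ = paint κ₁ z false
      w≢z : w ≢ z
      w≢z refl = E-irrefl w-z
      w-true : κ₂ w ≡ just true
      w-true = trans (unpainted κ₁ z w≢z) (painted κ w)
      z-false : κ₂ z ≡ just false
      z-false = painted κ₁ z
      other : ∀ {t} → t ≢ w → t ≢ z → κ₂ t ≡ κ t
      other t≢w t≢z = trans (unpainted κ₁ z t≢z) (unpainted κ w t≢w)
      keeps″ : ∀ {t c} → κ t ≡ just c → κ₂ t ≡ just c
      keeps″ eq = trans (other (λ { refl → just≢nothing (trans (sym eq) w-eq) })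
          (λ { refl → just≢nothing (trans (sym eq) z-eq) })) eq
      opposed″ : ∀ {t c} → κ₂ t ≡ just c → κ t ≡ just c ⊎ ∃ λ s → E t s × κ₂ s ≡ just (not c)
      opposed″ {t} {c} eq with t ≟ w | t ≟ z
      ... | yes refl | _        = inj₂
          (z , w-z , trans z-false (cong (just ∘ not) (just-injective (trans (sym w-true) eq))))
      ... | no _     | yes refl = inj₂
          (w , E-sym w-z , trans w-true (cong (just ∘ not) (just-injective (trans (sym z-false) eq))))
      ... | no t≢w   | no t≢z   = inj₁ (trans (sym (other t≢w t≢z)) eq)

    visit-all : ∀ (ws : List (Fin n)) κ → ∃ λ κ′ → Extension κ κ′ × (∀ {w} → w ∈ ws → κ′ w ≡ nothing → ∀ z → ¬ E w z)
    visit-all []       κ = κ , extension-refl , λ ()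
    visit-all (w ∷ ws) κ with visit κ w
    ... | κ₁ , ext₁ , alone₁ with visit-all ws κ₁
    ... | κ₂ , ext₂ , alone₂ = κ₂ , extension-trans ext₁ ext₂ , alone
      where
      still : κ₂ w ≡ nothing → κ₁ w ≡ nothing
      still eq with κ₁ w in eq₁
      ... | nothing = refl
      ... | just b  with trans (sym (keeps ext₂ eq₁)) eq
      ...   | ()
      alone : ∀ {t} → t ∈ w ∷ ws → κ₂ t ≡ nothing → ∀ z → ¬ E t z
      alone (here refl) eq = alone₁ (still eq)
      alone (there t∈)  eq = alone₂ t∈ eq

  -- Greedy: an uncoloured vertex takes the colour opposite to a neighbour's, and
  -- if that neighbour is uncoloured too, both are coloured at once.
  extend : ∀ κ → ∃ λ κ′ → Extension κ κ′ × (∀ {w} → κ′ w ≡ nothing → ∀ z → ¬ E w z)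
  extend κ = let κ′ , ext , alone = visit-all (allFin n) κ in κ′ , ext , λ {w} → alone (∈-allFin w)

-- Good colourings and the distances that they preserve

module _ {n} (G : Graph n) where

  -- The vertices of colour true keep their edge to u, the others keep their edge to v.
  record Good (u v : Fin n) (f : Fin n → Bool) : Set where
    field
      at-u      : f u ≡ true
      at-v      : f v ≡ false
      private-u : ∀ {a} → Private G u v a → f a ≡ true
      private-v : ∀ {b} → Private G v u b → f b ≡ false
      crossing  : ∃₂ λ x y → (Adj G u x × f x ≡ true) × (Adj G v y × f y ≡ false) × Adj G x y
      near      : ∀ {w} → Flank G u v w → ∃ λ z → Flank G u v z × f z ≡ not (f w) × Near G u v w z
      close     : ∀ {c} → Common G u v c → (∃ λ z → Flank G u v z × f z ≡ not (f c) × Adj G c z)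
                                         ⊎ (∃ λ r → Rest G u v r × Adj G c r)

  open Good

  good-swap : ∀ {u v f} → Good u v f → Good v u (not ∘ f)
  good-swap g .at-u = cong not (at-v g)
  good-swap g .at-v = cong not (at-u g)
  good-swap g .private-u b = cong not (private-v g b)
  good-swap g .private-v a = cong not (private-u g a)
  good-swap g .crossing = let x , y , (u~x , fx) , (v~y , fy) , x~y = crossing g
                          in y , x , (v~y , cong not fy) , (u~x , cong not fx) , adj-sym G x~y
  good-swap g .near w = let z , fl , eq , nr = near g (flank-swap G w) in z , flank-swap G fl , cong not eq , near-swap G nr
  good-swap g .close (v~c , u~c) with close g (u~c , v~c)
  ... | inj₁ (z , fl , eq , c~z) = inj₁ (z , flank-swap G fl , cong not eq , c~z)
  ... | inj₂ (r , ((r≢u , r≢v) , u≁r , v≁r) , c~r) = inj₂ (r , ((r≢v , r≢u) , v≁r , u≁r) , c~r)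

  -- Only surviving edges are recorded, as these are what keeps distances at most 3. That `u` and
  -- `v` end up far apart is shown separately, for the specific graph.
  record Kept (u v : Fin n) (f : Fin n → Bool) (H : Graph n) : Set where
    field
      kept-u : ∀ {w} → Adj G u w → f w ≡ true → Adj H u w
      kept-v : ∀ {w} → Adj G v w → f w ≡ false → Adj H v w
      kept   : ∀ {p q} → p ≢ u → p ≢ v → q ≢ u → q ≢ v → Adj G p q → Adj H p q

  open Kept

  kept-swap : ∀ {u v f H} → Kept u v f H → Kept v u (not ∘ f) H
  kept-swap {f = f} k .kept-u v~w eq = kept-v k v~w (trans (sym (not-involutive _)) (cong not eq))
  kept-swap {f = f} k .kept-v u~w eq = kept-u k u~w (trans (sym (not-involutive _)) (cong not eq))
  kept-swap k .kept a b c d = kept k b a d c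

  module _ (within2 : ∀ p q → Within2 G p q) where

    private
      module _ {u v f H} (g : Good u v f) (k : Kept u v f H) where

        kept= : ∀ {p q} → p ≢ u → p ≢ v → q ≢ u → q ≢ v → Adj= G p q → Adj= H p q
        kept= _ _ _ _ (inj₁ eq) = inj₁ eq
        kept= a b c d (inj₂ e)  = inj₂ (kept k a b c d e)

        true⇒u : ∀ {z} → Flank G u v z → f z ≡ true → Adj G u z
        true⇒u (inj₁ u~z , _) _ = u~z
        true⇒u {z} (inj₂ v~z , z≢u , _) fz = decidable-stable (adj? G u z) λ u≁z →
          true≢false (trans (sym fz) (private-v g (v~z , λ { (inj₁ eq) → z≢u (sym eq) ; (inj₂ e) → u≁z e })))

        -- A vertex adjacent to neither `u` nor `v` cannot have one of them as the midpoint of a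
        -- route of length 2, so the route that `within2` gives survives.
        rest-within2 : ∀ {r w} → Rest G u v r → w ≢ u → w ≢ v → Within2 H r w
        rest-within2 {r} {w} ((r≢u , r≢v) , u≁r , v≁r) w≢u w≢v with within2 r w
        ... | m , r-m , m-w = m , kept= r≢u r≢v m≢u m≢v r-m , kept= m≢u m≢v w≢u w≢v m-w
          where
          m≢u : m ≢ u
          m≢u refl = u≁r (adj-sym G (adj=⇒adj G r≢u r-m))
          m≢v : m ≢ v
          m≢v refl = v≁r (adj-sym G (adj=⇒adj G r≢v r-m))

        -- A vertex on the side of `v` is reached from `u` through its partner `z`: one edge to `z`,
        -- then at most two edges that avoid `u` and `v`. This is the purpose of `near`.
        u-flank : ∀ {w} → Flank G u v w → Within3 H u w
        u-flank {w} fl@(e , w≢u , w≢v) with f w in fw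
        ... | true  = within2⇒3 H (w , inj₂ (kept-u k (true⇒u fl fw) fw) , inj₁ refl)
        ... | false with near g fl
        ...   | z , flz@(_ , z≢u , z≢v) , fz , m , (m≢u , m≢v) , w-m , m-z =
          z , inj₂ (kept-u k (true⇒u flz fz′) fz′) , m , kept= z≢u z≢v m≢u m≢v (adj=-sym G m-z) , kept= m≢u m≢v w≢u
              w≢v (adj=-sym G w-m)
          where
          fz′ : f z ≡ true
          fz′ = trans fz (cong not fw)

        u-within3 : ∀ w → w ≢ u → w ≢ v → Within3 H u w
        u-within3 w w≢u w≢v with adj? G u w | adj? G v w
        ... | yes u~w | _       = u-flank (inj₁ u~w , w≢u , w≢v)
        ... | no _    | yes v~w = u-flank (inj₂ v~w , w≢u , w≢v)
        ... | no u≁w  | no v≁w  =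
          let x , _ , (u~x , fx) , _ = crossing g
              m , w-m , m-x = rest-within2 ((w≢u , w≢v) , u≁w , v≁w) (adj⇒≢ G u~x ∘ sym)
                  (λ { refl → true≢false (trans (sym fx) (at-v g)) })
          in x , inj₂ (kept-u k u~x fx) , m , adj=-sym H m-x , adj=-sym H w-m

        u-v : Within3 H u v
        u-v = let x , y , (u~x , fx) , (v~y , fy) , x~y = crossing g
              in x , inj₂ (kept-u k u~x fx) , y , inj₂
                  (kept k (adj⇒≢ G u~x ∘ sym) (λ { refl → true≢false (trans (sym fx) (at-v g)) })
                                                        (λ { refl → true≢false (trans (sym (at-u g)) fy) })
                                                          (adj⇒≢ G v~y ∘ sym) x~y)
               , inj₂ (adj-sym H (kept-v k v~y fy))

        -- The route from `p` to `q` through `u` is broken, as `q` now belongs to `v`. A neighbour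
        -- `z` of `q` with the other colour is on the side of `u` and gives the walk `p u z q`; a
        -- neighbour `r` in `Rest` is still within distance 2 of `p`. Hence `Good` asks for `close`
        -- in addition to `near`.
        mixed : ∀ {p q} → p ≢ u → p ≢ v → Adj G u p → f p ≡ true → Common G u v q → f q ≡ false → Within3 H p q
        mixed {p} {q} p≢u p≢v u~p fp c@(u~q , v~q) fq with close g c
        ... | inj₁ (z , fl@(_ , z≢u , z≢v) , fz , q~z) =
          u , inj₂ (adj-sym H (kept-u k u~p fp)) , z , inj₂ (kept-u k (true⇒u fl fz′) fz′)
            , inj₂ (kept k z≢u z≢v (adj⇒≢ G u~q ∘ sym) (adj⇒≢ G v~q ∘ sym) (adj-sym G q~z))
          where
          fz′ : f z ≡ true
          fz′ = trans fz (cong not fq)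
        ... | inj₂ (r , rest@((r≢u , r≢v) , _) , q~r) =
          within3-sym H (r , inj₂ (kept k (adj⇒≢ G u~q ∘ sym) (adj⇒≢ G v~q ∘ sym) r≢u r≢v q~r) ,
              rest-within2 rest p≢u p≢v)

        false⇒common : ∀ {q} → q ≢ v → Adj G u q → f q ≡ false → Common G u v q
        false⇒common {q} q≢v u~q fq = u~q , decidable-stable (adj? G v q) λ v≁q →
          true≢false (trans (sym (private-u g (u~q , λ { (inj₁ eq) → q≢v (sym eq) ; (inj₂ e) → v≁q e }))) fq)

        through-u : ∀ {p q} → p ≢ u → p ≢ v → q ≢ u → q ≢ v → Adj G u p → Adj G u q → Within3 H p q
        through-u {p} {q} p≢u p≢v q≢u q≢v u~p u~q with f p in fp | f q in fq
        ... | true  | true  = within2⇒3 H (u , inj₂ (adj-sym H (kept-u k u~p fp)) , inj₂ (kept-u k u~q fq))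
        -- Neighbours of `u` coloured false are common neighbours, so `v` takes over as the
        -- midpoint.
        ... | false | false = within2⇒3 H
            (v , inj₂ (adj-sym H (kept-v k (proj₂ (false⇒common p≢v u~p fp)) fp)) , inj₂
            (kept-v k (proj₂ (false⇒common q≢v u~q fq)) fq))
        ... | true  | false = mixed p≢u p≢v u~p fp (false⇒common q≢v u~q fq) fq
        ... | false | true  = within3-sym H (mixed q≢u q≢v u~q fq (false⇒common p≢v u~p fp) fp)

    -- Away from `u` and `v`, a pair loses its route of length 2 only if the midpoint is `u` or `v`.
    -- Complementing the colouring exchanges the two, so each case is treated for `u` only.
    good⇒within3 : ∀ {u v f H} → Good u v f → Kept u v f H → ∀ p q → Within3 H p q
    good⇒within3 {u} {v} {f} {H} g k p q with p ≟ u | p ≟ v | q ≟ u | q ≟ v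
    ... | yes refl | _        | yes refl | _        = p , inj₁ refl , p , inj₁ refl , inj₁ refl
    ... | yes refl | _        | no _     | yes refl = u-v g k
    ... | yes refl | _        | no q≢u   | no q≢v   = u-within3 g k q q≢u q≢v
    ... | no _     | yes refl | yes refl | _        = within3-sym H (u-v g k)
    ... | no _     | yes refl | no _     | yes refl = p , inj₁ refl , p , inj₁ refl , inj₁ refl
    ... | no _     | yes refl | no q≢u   | no q≢v   = u-within3 (good-swap g) (kept-swap k) q q≢v q≢u
    ... | no p≢u   | no p≢v   | yes refl | _        = within3-sym H (u-within3 g k p p≢u p≢v)
    ... | no p≢u   | no p≢v   | no _     | yes refl = within3-sym H (u-within3 (good-swap g) (kept-swap k) p p≢v p≢u)
    ... | no p≢u   | no p≢v   | no q≢u   | no q≢v   with within2 p q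
    ...   | m , p-m , m-q with m ≟ u | m ≟ v
    ...     | yes refl | _        = through-u g k p≢u p≢v q≢u q≢v (adj-sym G (adj=⇒adj G p≢u p-m))
        (adj=⇒adj G (q≢u ∘ sym) m-q)
    ...     | no _     | yes refl = through-u (good-swap g) (kept-swap k) p≢v p≢u q≢v q≢u
        (adj-sym G (adj=⇒adj G p≢v p-m)) (adj=⇒adj G (q≢v ∘ sym) m-q)
    ...     | no m≢u   | no m≢v   = within2⇒3 H (m , kept= g k p≢u p≢v m≢u m≢v p-m , kept= g k m≢u m≢v q≢u q≢v m-q)

-- The colouring grown from a set of seeds

module _ {n} (G : Graph n) where

  data Position (u v w : Fin n) : Set where
    is-u         : w ≡ u → Position u v w
    is-v         : w ≡ v → Position u v w
    in-private-u : Private G u v w → Position u v w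
    in-private-v : Private G v u w → Position u v w
    in-common    : Common G u v w → Position u v w
    in-rest      : Rest G u v w → Position u v w

  position : ∀ u v w → Position u v w
  position u v w with w ≟ u | w ≟ v | adj? G u w | adj? G v w
  ... | yes eq  | _      | _       | _       = is-u eq
  ... | no _    | yes eq | _       | _       = is-v eq
  ... | no _    | no _   | yes u~w | yes v~w = in-common (u~w , v~w)
  ... | no _    | no w≢v | yes u~w | no v≁w  = in-private-u (u~w , λ { (inj₁ eq) → w≢v (sym eq) ; (inj₂ e) → v≁w e })
  ... | no w≢u  | no _   | no u≁w  | yes v~w = in-private-v (v~w , λ { (inj₁ eq) → w≢u (sym eq) ; (inj₂ e) → u≁w e })
  ... | no w≢u  | no w≢v | no u≁w  | no v≁w  = in-rest ((w≢u , w≢v) , u≁w , v≁w)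

  private⇒flank : ∀ {u v a} → Private G u v a → Flank G u v a
  private⇒flank (u~a , v≁a) = inj₁ u~a , adj⇒≢ G u~a ∘ sym , λ { refl → v≁a (inj₁ refl) }

  common⇒flank : ∀ {u v c} → Common G u v c → Flank G u v c
  common⇒flank (u~c , v~c) = inj₁ u~c , adj⇒≢ G u~c ∘ sym , adj⇒≢ G v~c ∘ sym

  -- Seed is a set of common neighbours of u and v to be coloured false, which
  -- serves those vertices of Private u v that are near no vertex of Private v u.
  record Seeding (u v x y : Fin n) (Seed : Fin n → Set) : Set where
    field
      u≢v      : u ≢ v
      u~x      : Adj G u x
      x≢v      : x ≢ v
      v~y      : Adj G v y
      y≢u      : y ≢ u
      x~y      : Adj G x y
      partner  : ∀ c → Common G u v c → ∃ λ w → Flank G u v w × w ≢ c × Near G u v c w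
      seed?    : Decidable Seed
      seed-ok  : ∀ {c} → Common G u v c → Seed c → ∃ λ a → Private G u v a × Near G u v c a
                                                          × (Adj G c a ⊎ ∃ λ r → Rest G u v r × Adj G c r)
      private-u-ok : ∀ {a} → Private G u v a → ∃ λ z → Near G u v a z ×
          (Private G v u z ⊎ z ≡ y ⊎ (Common G u v z × Seed z × z ≢ x))
      private-v-ok : ∀ {b} → Private G v u b → ∃ λ z → Near G u v b z × (Private G u v z ⊎ z ≡ x)

  module _ {u v x y Seed} (s : Seeding u v x y Seed) where
    open Seeding s

    private
      u-x-flank : Flank G u v x
      u-x-flank = inj₁ u~x , adj⇒≢ G u~x ∘ sym , x≢v
      v-y-flank : Flank G u v y
      v-y-flank = inj₂ v~y , y≢u , adj⇒≢ G v~y ∘ sym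
      x≢y : x ≢ y
      x≢y = adj⇒≢ G x~y

      -- The order of the tests matters: `x` stays on the side of `u` even if it is a seed, which is
      -- why a seed that serves a private vertex must differ from `x`.
      common-seed : Fin n → Maybe Bool
      common-seed c with c ≟ x | c ≟ y | seed? c
      ... | yes _ | _     | _     = just true
      ... | no _  | yes _ | _     = just false
      ... | no _  | no _  | yes _ = just false
      ... | no _  | no _  | no _  = nothing

      κ₀ : Colouring n
      κ₀ w with position u v w
      ... | is-u _         = just true
      ... | is-v _         = just false
      ... | in-private-u _ = just true
      ... | in-private-v _ = just false
      ... | in-common _    = common-seed w
      ... | in-rest _      = nothing

      κ₀-u : κ₀ u ≡ just true
      κ₀-u with position u v u
      ... | is-u _                    = refl
      ... | is-v eq                   = ⊥-elim (u≢v eq)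
      ... | in-private-u (e , _)      = ⊥-elim (adj-irrefl G e)
      ... | in-private-v (_ , ¬e)     = ⊥-elim (¬e (inj₁ refl))
      ... | in-common (e , _)         = ⊥-elim (adj-irrefl G e)
      ... | in-rest ((u≢u , _) , _)   = ⊥-elim (u≢u refl)

      κ₀-v : κ₀ v ≡ just false
      κ₀-v with position u v v
      ... | is-u eq                   = ⊥-elim (u≢v (sym eq))
      ... | is-v _                    = refl
      ... | in-private-u (_ , ¬e)     = ⊥-elim (¬e (inj₁ refl))
      ... | in-private-v (e , _)      = ⊥-elim (adj-irrefl G e)
      ... | in-common (_ , e)         = ⊥-elim (adj-irrefl G e)
      ... | in-rest ((_ , v≢v) , _)   = ⊥-elim (v≢v refl)

      κ₀-private-u : ∀ {a} → Private G u v a → κ₀ a ≡ just true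
      κ₀-private-u {a} (u~a , v≁a) with position u v a
      ... | is-u _                    = refl
      ... | is-v refl                 = ⊥-elim (v≁a (inj₁ refl))
      ... | in-private-u _            = refl
      ... | in-private-v (e , _)      = ⊥-elim (v≁a (inj₂ e))
      ... | in-common (_ , e)         = ⊥-elim (v≁a (inj₂ e))
      ... | in-rest (_ , ¬e , _)      = ⊥-elim (¬e u~a)

      κ₀-private-v : ∀ {b} → Private G v u b → κ₀ b ≡ just false
      κ₀-private-v {b} (v~b , u≁b) with position u v b
      ... | is-u refl                 = ⊥-elim (u≁b (inj₁ refl))
      ... | is-v _                    = refl
      ... | in-private-u (e , _)      = ⊥-elim (u≁b (inj₂ e))
      ... | in-private-v _            = refl
      ... | in-common (e , _)         = ⊥-elim (u≁b (inj₂ e))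
      ... | in-rest (_ , _ , ¬e)      = ⊥-elim (¬e v~b)

      κ₀-common : ∀ {c} → Common G u v c → κ₀ c ≡ common-seed c
      κ₀-common {c} (u~c , v~c) with position u v c
      ... | is-u refl                 = ⊥-elim (adj-irrefl G u~c)
      ... | is-v refl                 = ⊥-elim (adj-irrefl G v~c)
      ... | in-private-u (_ , ¬e)     = ⊥-elim (¬e (inj₂ v~c))
      ... | in-private-v (_ , ¬e)     = ⊥-elim (¬e (inj₂ u~c))
      ... | in-common _               = refl
      ... | in-rest (_ , ¬e , _)      = ⊥-elim (¬e u~c)

      κ₀-x : κ₀ x ≡ just true
      κ₀-x = go (adj? G v x)
        where
        go : Dec (Adj G v x) → κ₀ x ≡ just true
        go (no v≁x)  = κ₀-private-u (u~x , λ { (inj₁ eq) → x≢v (sym eq) ; (inj₂ e) → v≁x e })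
        go (yes v~x) = trans (κ₀-common (u~x , v~x)) at-x
          where
          at-x : common-seed x ≡ just true
          at-x with x ≟ x
          ... | yes _  = refl
          ... | no x≢x = ⊥-elim (x≢x refl)

      κ₀-y : κ₀ y ≡ just false
      κ₀-y = go (adj? G u y)
        where
        go : Dec (Adj G u y) → κ₀ y ≡ just false
        go (no u≁y)  = κ₀-private-v (v~y , λ { (inj₁ eq) → y≢u (sym eq) ; (inj₂ e) → u≁y e })
        go (yes u~y) = trans (κ₀-common (u~y , v~y)) at-y
          where
          at-y : common-seed y ≡ just false
          at-y with y ≟ x | y ≟ y
          ... | yes y≡x | _      = ⊥-elim (x≢y (sym y≡x))
          ... | no _    | yes _  = refl
          ... | no _    | no y≢y = ⊥-elim (y≢y refl)

      κ₀-seed : ∀ {c} → Common G u v c → Seed c → c ≢ x → κ₀ c ≡ just false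
      κ₀-seed {c} common seed c≢x = trans (κ₀-common common) at-c
        where
        at-c : common-seed c ≡ just false
        at-c with c ≟ x | c ≟ y | seed? c
        ... | yes c≡x | _     | _       = ⊥-elim (c≢x c≡x)
        ... | no _    | yes _ | _       = refl
        ... | no _    | no _  | yes _   = refl
        ... | no _    | no _  | no ¬sd  = ⊥-elim (¬sd seed)

      seed-origin : ∀ c {b} → common-seed c ≡ just b → (c ≡ x × b ≡ true) ⊎ (c ≡ y × b ≡ false) ⊎ (Seed c × b ≡ false)
      seed-origin c eq with c ≟ x | c ≟ y | seed? c
      ... | yes c≡x | _       | _      = inj₁ (c≡x , sym (just-injective eq))
      ... | no _    | yes c≡y | _      = inj₂ (inj₁ (c≡y , sym (just-injective eq)))
      ... | no _    | no _    | yes sd = inj₂ (inj₂ (sd , sym (just-injective eq)))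

      E₁ E₂ : Fin n → Fin n → Set
      E₁ p q = Flank G u v p × Flank G u v q × Adj G p q
      E₂ p q = Flank G u v p × Flank G u v q × p ≢ q × Near G u v p q

      E₁? : Decidable₂ E₁
      E₁? p q = flank? G u v p ×-dec flank? G u v q ×-dec adj? G p q
      E₂? : Decidable₂ E₂
      E₂? p q = flank? G u v p ×-dec flank? G u v q ×-dec ¬? (p ≟ q) ×-dec near? G u v p q

      E₁-sym : Symmetric E₁
      E₁-sym (a , b , e) = b , a , adj-sym G e
      E₂-sym : Symmetric E₂
      E₂-sym (a , b , ne , nr) = b , a , ne ∘ sym , near-sym G nr

      E₁-irrefl : ∀ {w} → ¬ E₁ w w
      E₁-irrefl (_ , _ , e) = adj-irrefl G e
      E₂-irrefl : ∀ {w} → ¬ E₂ w w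
      E₂-irrefl (_ , _ , ne , _) = ne refl

      first = extend E₁? E₁-sym E₁-irrefl κ₀
      κ₁ : Colouring n
      κ₁ = proj₁ first
      second = extend E₂? E₂-sym E₂-irrefl κ₁
      κ₂ : Colouring n
      κ₂ = proj₁ second

      module Ext₁ = Extension (proj₁ (proj₂ first))
      module Ext₂ = Extension (proj₁ (proj₂ second))

      keeps : ∀ {w b} → κ₀ w ≡ just b → κ₂ w ≡ just b
      keeps = Ext₂.keeps ∘ Ext₁.keeps

    -- The default reaches only vertices of `Rest`: `u`, `v` and the private vertices are coloured
    -- from the start, and `coloured` takes care of the common neighbours.
    good-colour : Fin n → Bool
    good-colour w = fromMaybe true (κ₂ w)

    private
      f : Fin n → Bool
      f = good-colour

      f-of : ∀ {w b} → κ₂ w ≡ just b → f w ≡ b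
      f-of eq = cong (fromMaybe true) eq

      f₀ : ∀ {w b} → κ₀ w ≡ just b → f w ≡ b
      f₀ = f-of ∘ keeps

      against : ∀ {w z b} → f w ≡ b → f z ≡ not b → f z ≡ not (f w)
      against fw fz = trans fz (cong not (sym fw))

      -- `partner` supplies a neighbour with respect to `E₂`, and the second phase leaves a vertex
      -- uncoloured only if it has none.
      coloured : ∀ {c} → Common G u v c → ∃ λ b → κ₂ c ≡ just b
      coloured {c} common with κ₂ c in eq
      ... | just b  = b , refl
      ... | nothing = let w , fl , w≢c , nr = partner c common
                      in ⊥-elim (proj₂ (proj₂ second) eq w (common⇒flank common , fl , w≢c ∘ sym , nr))

      Served : Fin n → Set
      Served c = (∃ λ z → Flank G u v z × f z ≡ not (f c) × Near G u v c z)
               × ((∃ λ z → Flank G u v z × f z ≡ not (f c) × Adj G c z) ⊎ (∃ λ r → Rest G u v r × Adj G c r))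

      served-adj : ∀ {c z} → Flank G u v c → Flank G u v z → f z ≡ not (f c) → Adj G c z → Served c
      served-adj (_ , c≢u , c≢v) fl eq c~z = (_ , fl , eq , near-adj G c≢u c≢v c~z) , inj₁ (_ , fl , eq , c~z)

      served-seed : ∀ {c b} → Common G u v c → κ₀ c ≡ just b → Served c
      served-seed {c} common eq with seed-origin c (trans (sym (κ₀-common common)) eq)
      ... | inj₁ (refl , refl) = served-adj u-x-flank v-y-flank (against (f₀ κ₀-x) (f₀ κ₀-y)) x~y
      ... | inj₂ (inj₁ (refl , refl)) = served-adj v-y-flank u-x-flank (against (f₀ κ₀-y) (f₀ κ₀-x)) (adj-sym G x~y)
      ... | inj₂ (inj₂ (seed , refl)) with seed-ok common seed
      ...   | a , pa , nr , inj₁ c~a = served-adj (common⇒flank common) (private⇒flank pa)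
          (against (f₀ eq) (f₀ (κ₀-private-u pa))) c~a
      ...   | a , pa , nr , inj₂ rest =
          (a , private⇒flank pa , against (f₀ eq) (f₀ (κ₀-private-u pa)) , nr) , inj₂ rest

      served₁ : ∀ {c b} → Common G u v c → κ₁ c ≡ just b → Served c
      served₁ common eq with Ext₁.opposed eq
      ... | inj₁ eq₀ = served-seed common eq₀
      ... | inj₂ (z , (fl , flz , c~z) , eqz) =
          served-adj fl flz (against (f-of (Ext₂.keeps eq)) (f-of (Ext₂.keeps eqz))) c~z

      -- This is why edges come before pairs at distance 2. A vertex `c` first coloured in the
      -- second phase is adjacent to no vertex of `Flank`. So the midpoint `m` on the way to its
      -- partner is a genuine neighbour of `c` outside `Flank`, hence in `Rest`, and it provides the
      -- second alternative of `close`.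
      served : ∀ {c} → Common G u v c → Served c
      served {c} common with κ₁ c in eq₁
      ... | just _  = served₁ common eq₁
      ... | nothing with coloured common
      ...   | b , eq₂ with Ext₂.opposed eq₂
      ...     | inj₁ eq = ⊥-elim (just≢nothing (trans (sym eq) eq₁))
      ...     | inj₂ (z , (fl@(_ , c≢u , c≢v) , flz , c≢z , nr@(m , (m≢u , m≢v) , c-m , m-z)) , eqz) =
        (z , flz , against (f-of eq₂) (f-of eqz) , nr) , inj₂ (m , m-rest (position u v m) , c~m)
        where
        isolated : ∀ t → ¬ E₁ c t
        isolated = proj₂ (proj₂ first) eq₁
        c≢m : c ≢ m
        c≢m refl = isolated z (fl , flz , adj=⇒adj G c≢z m-z)
        c~m : Adj G c m
        c~m = adj=⇒adj G c≢m c-m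
        m-rest : Position u v m → Rest G u v m
        m-rest (is-u eq) = ⊥-elim (m≢u eq)
        m-rest (is-v eq) = ⊥-elim (m≢v eq)
        m-rest (in-private-u (u~m , _)) = ⊥-elim (isolated m (fl , (inj₁ u~m , m≢u , m≢v) , c~m))
        m-rest (in-private-v (v~m , _)) = ⊥-elim (isolated m (fl , (inj₂ v~m , m≢u , m≢v) , c~m))
        m-rest (in-common (u~m , _)) = ⊥-elim (isolated m (fl , (inj₁ u~m , m≢u , m≢v) , c~m))
        m-rest (in-rest r) = r

      served-near : ∀ {w} → Flank G u v w → Position u v w → ∃ λ z → Flank G u v z × f z ≡ not (f w) × Near G u v w z
      served-near (_ , w≢u , _) (is-u eq) = ⊥-elim (w≢u eq)
      served-near (_ , _ , w≢v) (is-v eq) = ⊥-elim (w≢v eq)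
      served-near _ (in-private-u pa) with private-u-ok pa
      ... | z , nr , inj₁ pz = z , flank-swap G (private⇒flank pz) , against (f₀ (κ₀-private-u pa))
          (f₀ (κ₀-private-v pz)) , nr
      ... | z , nr , inj₂ (inj₁ refl) = z , v-y-flank , against (f₀ (κ₀-private-u pa)) (f₀ κ₀-y) , nr
      ... | z , nr , inj₂ (inj₂ (cz , sz , z≢x)) =
          z , common⇒flank cz , against (f₀ (κ₀-private-u pa)) (f₀ (κ₀-seed cz sz z≢x)) , nr
      served-near _ (in-private-v pb) with private-v-ok pb
      ... | z , nr , inj₁ pz = z , private⇒flank pz , against (f₀ (κ₀-private-v pb)) (f₀ (κ₀-private-u pz)) , nr
      ... | z , nr , inj₂ refl = z , u-x-flank , against (f₀ (κ₀-private-v pb)) (f₀ κ₀-x) , nr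
      served-near _ (in-common common) = proj₁ (served common)
      served-near (inj₁ u~w , _) (in-rest (_ , u≁w , _)) = ⊥-elim (u≁w u~w)
      served-near (inj₂ v~w , _) (in-rest (_ , _ , v≁w)) = ⊥-elim (v≁w v~w)

    seeding⇒good : Good G u v good-colour
    seeding⇒good = record
      { at-u      = f₀ κ₀-u
      ; at-v      = f₀ κ₀-v
      ; private-u = f₀ ∘ κ₀-private-u
      ; private-v = f₀ ∘ κ₀-private-v
      ; crossing  = x , y , (u~x , f₀ κ₀-x) , (v~y , f₀ κ₀-y) , x~y
      ; near      = λ {w} fl → served-near fl (position u v w)
      ; close     = proj₂ ∘ served }

  separable-swap : ∀ {u v x y} → Separable G u v x y → Separable G v u y x
  separable-swap (ux , vy , x~y , pu , pv , co) = vy , ux , adj-sym G x~y ,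
    (λ b p → let z , a , ne , nr = pv b p in z , a , ne , near-swap G nr) ,
    (λ a p → let z , b , ne , nr = pu a p in z , b , ne , near-swap G nr) ,
    (λ c (v~c , u~c) → let w , fl , ne , nr = co c (u~c , v~c) in w , flank-swap G fl , ne , near-swap G nr)

  -- Choice of the seeds in a graph of diameter at most 2

  module _ (within2 : ∀ p q → Within2 G p q) where

    -- Neither `u` nor `v` can be the midpoint: `u` does not see `b`, and `v` does not see `a`.
    private-near : ∀ {u v a b} → Private G u v a → Private G v u b → Near G u v a b
    private-near {u} {v} {a} {b} (u~a , v≁a) (v~b , u≁b) with within2 a b
    ... | m , a-m , m-b = m , (m≢u , m≢v) , a-m , m-b
      where
      m≢u : m ≢ u
      m≢u refl = u≁b m-b
      m≢v : m ≢ v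
      m≢v refl = v≁a (adj=-sym G a-m)

    -- Private vertices on both sides serve each other by `private-near`, so no common neighbour has
    -- to be forced and the seed set is empty.
    unseeded : ∀ {u v x y} → u ≢ v → Separable G u v x y →
      (∀ {a} → Private G u v a → ∃ (Private G v u)) → (∀ {b} → Private G v u b → ∃ (Private G u v)) →
      ∃ (Good G u v)
    unseeded {u} {v} {x} {y} u≢v ((u~x , x≢v) , (v~y , y≢u) , x~y , _ , _ , partner) other other′ =
        _ , seeding⇒good seeding
      where
      seeding : Seeding u v x y (λ _ → ⊥)
      seeding = record
        { u≢v = u≢v ; u~x = u~x ; x≢v = x≢v ; v~y = v~y ; y≢u = y≢u ; x~y = x~y ; partner = partner
        ; seed? = λ _ → no λ () ; seed-ok = λ _ ()
        ; private-u-ok = λ pa → let b , pb = other pa in b , private-near pa pb , inj₁ pb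
        ; private-v-ok = λ pb → let a , pa = other′ pb in a , near-sym G (private-near pa pb) , inj₁ pa }

    -- The seeds are the common neighbours that see Private u v directly or across one vertex of Rest.
    seeded : ∀ {u v x y} → u ≢ v → Separable G u v x y → (∀ {b} → ¬ Private G v u b) →
      Private G u v x ⊎ (∀ {a c} → Private G u v a → Common G u v c → ¬ Adj G a c) → ∃ (Good G u v)
    seeded {u} {v} {x} {y} u≢v ((u~x , x≢v) , (v~y , y≢u) , x~y , toward-v , _ , partner) none choice =
        _ , seeding⇒good seeding
      where
      Seed : Fin n → Set
      Seed c = (∃ λ a → Private G u v a × Adj G c a) ⊎
          (∃ λ r → (Rest G u v r × Adj G c r) × ∃ λ a → Private G u v a × Adj G r a)
      seed? : Decidable Seed
      seed? c = Fin.any? (λ a → private? G u v a ×-dec adj? G c a)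
          ⊎-dec Fin.any? (λ r → (rest? G u v r ×-dec adj? G c r) ×-dec Fin.any?
              (λ a → private? G u v a ×-dec adj? G r a))
      seed-ok : ∀ {c} → Common G u v c → Seed c → ∃ λ a → Private G u v a × Near G u v c a ×
          (Adj G c a ⊎ ∃ λ r → Rest G u v r × Adj G c r)
      seed-ok (u~c , v~c) (inj₁ (a , pa , c~a)) =
          a , pa , near-adj G (adj⇒≢ G u~c ∘ sym) (adj⇒≢ G v~c ∘ sym) c~a , inj₁ c~a
      seed-ok _ (inj₂ (r , (rest , c~r) , a , pa , r~a)) =
          a , pa , (r , proj₁ rest , inj₂ c~r , inj₂ r~a) , inj₂ (r , rest , c~r)
      Target : Fin n → Set
      Target z = Private G v u z ⊎ z ≡ y ⊎ (Common G u v z × Seed z × z ≢ x)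
      -- `z` is the vertex that separability offers to `a`, and `m` the midpoint between them. If
      -- `m` is private or in `Rest`, then `z` is a seed. If `m` is common, then `m` is itself a
      -- seed and serves `a` in place of `z`, but it might be `x`. This is what `choice` excludes:
      -- either `x` is private and so differs from `m`, or no private vertex is adjacent to a common
      -- one.
      serve : ∀ {a z m} → Private G u v a → Common G u v z → z ≢ x → m ≢ u → m ≢ v → Adj= G a m → Adj= G m z →
              Dec (a ≡ m) → Position u v m → ∃ λ t → Near G u v a t × Target t
      serve {a} {z} pa@(_ , v≁a) cz@(_ , v~z) z≢x m≢u m≢v a-m m-z (yes refl) _ =
        z , (a , (m≢u , m≢v) , inj₁ refl , m-z) , inj₂
            (inj₂ (cz , inj₁ (a , pa , adj-sym G (adj=⇒adj G (λ { refl → v≁a (inj₂ v~z) }) m-z)) , z≢x))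
      serve pa cz z≢x m≢u m≢v a-m m-z (no _) (is-u eq) = ⊥-elim (m≢u eq)
      serve pa cz z≢x m≢u m≢v a-m m-z (no _) (is-v eq) = ⊥-elim (m≢v eq)
      serve {z = z} {m} pa cz@(_ , v~z) z≢x m≢u m≢v a-m m-z (no _) (in-private-u pm@(_ , v≁m)) =
        z , (m , (m≢u , m≢v) , a-m , m-z) , inj₂
            (inj₂ (cz , inj₁ (m , pm , adj-sym G (adj=⇒adj G (λ { refl → v≁m (inj₂ v~z) }) m-z)) , z≢x))
      serve pa cz z≢x m≢u m≢v a-m m-z (no _) (in-private-v pm) = ⊥-elim (none pm)
      serve {a} {m = m} pa cz z≢x m≢u m≢v a-m m-z (no a≢m) (in-common cm@(_ , v~m)) =
        [ (λ (_ , v≁x) → m , (m , (m≢u , m≢v) , inj₂ a~m , inj₁ refl) ,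
             inj₂ (inj₂ (cm , inj₁ (a , pa , adj-sym G a~m) , λ m≡x → v≁x (inj₂ (subst (Adj G v) m≡x v~m)))))
        , (λ apart → ⊥-elim (apart pa cm a~m)) ]′ choice
        where
        a~m : Adj G a m
        a~m = adj=⇒adj G a≢m a-m
      serve {a} {z} {m} pa cz@(u~z , _) z≢x m≢u m≢v a-m m-z (no a≢m) (in-rest rest@(_ , u≁m , _)) =
        z , (m , (m≢u , m≢v) , a-m , m-z) ,
        inj₂ (inj₂ (cz , inj₂ (m , (rest , adj-sym G (adj=⇒adj G (λ { refl → u≁m u~z }) m-z)) , a , pa , adj-sym G
            (adj=⇒adj G a≢m a-m)) , z≢x))
      private-u-ok : ∀ {a} → Private G u v a → ∃ λ t → Near G u v a t × Target t
      private-u-ok {a} pa with toward-v a pa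
      ... | z , (v~z , z≢u) , z≢x , m , (m≢u , m≢v) , a-m , m-z with adj? G u z
      ...   | no u≁z  = ⊥-elim (none (v~z , λ { (inj₁ eq) → z≢u (sym eq) ; (inj₂ e) → u≁z e }))
      ...   | yes u~z = serve pa (u~z , v~z) z≢x m≢u m≢v a-m m-z (a ≟ m) (position u v m)
      seeding : Seeding u v x y Seed
      seeding = record
        { u≢v = u≢v ; u~x = u~x ; x≢v = x≢v ; v~y = v~y ; y≢u = y≢u ; x~y = x~y ; partner = partner
        ; seed? = seed? ; seed-ok = seed-ok ; private-u-ok = private-u-ok ; private-v-ok = ⊥-elim ∘ none }

    -- If a private `a` is adjacent to a common `c`, the path `u a c v` replaces `u x y v`.
    -- Separability is not lost: the vertices `z` that it offers are adjacent to `v`, while `a` is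
    -- not, so they all differ from `a`.
    one-sided : ∀ {u v x y} → u ≢ v → Separable G u v x y → (∀ {b} → ¬ Private G v u b) → ∃ (Good G u v)
    one-sided {u} {v} {x} {y} u≢v sep@(ux , vy , x~y , toward-v , toward-u , partner) none
      with Fin.any? (λ a → private? G u v a ×-dec Fin.any? (λ c → common? G u v c ×-dec adj? G a c))
    ... | no apart = seeded u≢v sep none (inj₂ λ pa cc a~c → apart (_ , pa , _ , cc , a~c))
    ... | yes (a , pa@(u~a , v≁a) , c , (u~c , v~c) , a~c) = seeded u≢v
      ((u~a , (λ { refl → v≁a (inj₁ refl) })) , (v~c , adj⇒≢ G u~c ∘ sym) , a~c ,
       (λ a′ pa′ → let z , (v~z , z≢u) , _ , nr = toward-v a′ pa′ in z , (v~z , z≢u) , (λ { refl → v≁a (inj₂ v~z) }) , nr) ,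
       (λ b pb → ⊥-elim (none pb)) , partner) none (inj₁ pa)

    separable⇒good : ∀ {u v x y} → u ≢ v → Separable G u v x y → ∃ (Good G u v)
    separable⇒good {u} {v} u≢v sep with Fin.any? (private? G u v) | Fin.any? (private? G v u)
    ... | _      | no none = one-sided u≢v sep (λ pb → none (_ , pb))
    ... | no none | yes _  = let f , g = one-sided (u≢v ∘ sym) (separable-swap sep) (λ pa → none (_ , pa)) in not ∘ f , good-swap G g
    ... | yes a  | yes b   = unseeded u≢v sep (λ _ → b) (λ _ → a)

-- Counting removed edges

length-inject : ∀ {A B : Set} (h : A → B) {xs ys} → Unique xs → (∀ {x} → x ∈ xs → h x ∈ ys) →
  (∀ {x x′} → x ∈ xs → x′ ∈ xs → h x ≡ h x′ → x ≡ x′) → length xs ≤ length ys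
length-inject h {[]} _ _ _ = z≤n
length-inject h {x ∷ xs} (fresh ∷ unique) into inj with ∈-∃++ (into (here refl))
... | as , bs , refl = ≤-trans (s≤s (length-inject h unique into′ (λ i j → inj (there i) (there j))))
    (≤-reflexive total)
  where
  total : suc (length (as ++ bs)) ≡ length (as ++ h x ∷ bs)
  total = trans (cong suc (List.length-++ as)) (trans (sym (+-suc (length as) (length bs))) (sym (List.length-++ as)))
  into′ : ∀ {x′} → x′ ∈ xs → h x′ ∈ as ++ bs
  into′ x′∈ with ∈-++⁻ as (into (there x′∈))
  ... | inj₁ i = ∈-++⁺ˡ i
  ... | inj₂ (there i) = ∈-++⁺ʳ as i
  ... | inj₂ (here eq) = ⊥-elim (All.lookup fresh x′∈ (sym (inj (there x′∈) (here refl) eq)))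

T-∧-not : ∀ {b} {A : Set} (a? : Dec A) → T (b ∧ not (does a?)) ⇔ (T b × ¬ A)
T-∧-not {true}  (yes a) = mk⇔ (λ ()) (λ (_ , ¬a) → ¬a a)
T-∧-not {true}  (no ¬a) = mk⇔ (λ _ → _ , ¬a) (λ _ → _)
T-∧-not {false} a?      = mk⇔ (λ ()) proj₁

module _ {n : ℕ} where

  -- The form in which `edges` lists an edge with these endpoints, so that edges can be counted
  -- without regard to orientation.
  pair : Fin n → Fin n → Fin n × Fin n
  pair p q with p Fin.<? q
  ... | yes _ = p , q
  ... | no  _ = q , p

  pair-< : ∀ {p q} → p Fin.< q → pair p q ≡ (p , q)
  pair-< {p} {q} p<q with p Fin.<? q
  ... | yes _  = refl
  ... | no p≮q = ⊥-elim (p≮q p<q)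

  pair-> : ∀ {p q} → q Fin.< p → pair p q ≡ (q , p)
  pair-> {p} {q} q<p with p Fin.<? q
  ... | yes p<q = ⊥-elim (Fin.<-asym p<q q<p)
  ... | no _    = refl

  pair-sym : ∀ {p q} → p ≢ q → pair p q ≡ pair q p
  pair-sym {p} {q} p≢q with Fin.<-cmp p q
  ... | tri< p<q _ _ = trans (pair-< p<q) (sym (pair-> p<q))
  ... | tri≈ _ eq _  = ⊥-elim (p≢q eq)
  ... | tri> _ _ q<p = trans (pair-> q<p) (sym (pair-< q<p))

  pair-ends : ∀ {p q p′ q′} → pair p q ≡ pair p′ q′ → (p ≡ p′ × q ≡ q′) ⊎ (p ≡ q′ × q ≡ p′)
  pair-ends {p} {q} {p′} {q′} eq with p Fin.<? q | p′ Fin.<? q′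
  pair-ends refl | yes _ | yes _ = inj₁ (refl , refl)
  pair-ends refl | yes _ | no _  = inj₂ (refl , refl)
  pair-ends refl | no _  | yes _ = inj₂ (refl , refl)
  pair-ends refl | no _  | no _  = inj₁ (refl , refl)

  module _ (E : EdgeSet n) where

    private
      IsEdge : Fin n × Fin n → Set
      IsEdge (p , q) = p Fin.< q × T (has E p q)
      edge? : Decidable IsEdge
      edge? (p , q) = (p Fin.<? q) ×-dec T? (has E p q)

    pair∈edges : ∀ {p q} → Adj E p q → pair p q ∈ edges E
    pair∈edges {p} {q} e with Fin.<-cmp p q
    ... | tri< p<q _ _ = subst (_∈ edges E) (sym (pair-< p<q))
                           (∈-filter⁺ edge? (∈-cartesianProduct⁺ (∈-allFin p) (∈-allFin q)) (p<q , e))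
    ... | tri≈ _ eq _  = ⊥-elim (adj⇒≢ E e eq)
    ... | tri> _ _ q<p = subst (_∈ edges E) (sym (pair-> q<p))
                           (∈-filter⁺ edge? (∈-cartesianProduct⁺ (∈-allFin q) (∈-allFin p)) (q<p , adj-sym E e))

    edges-sound : ∀ {p q} → (p , q) ∈ edges E → p Fin.< q × Adj E p q
    edges-sound i = proj₂ (∈-filter⁻ edge? {xs = cartesianProduct (allFin n) (allFin n)} i)

    edges-unique : Unique (edges E)
    edges-unique = Unique.filter⁺ edge? (Unique.cartesianProduct⁺ (Unique.allFin⁺ n) (Unique.allFin⁺ n))

  -- The set N(u) ∩ N[v]. Its possible member `w` = `v` stands for the edge `uv`, the others for the
  -- paths of length 2 from `u` to `v`.
  Junction : Graph n → (u v w : Fin n) → Set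
  Junction G u v w = Adj G u w × Adj= G v w

  module _ (G : Graph n) (F : EdgeSet n) where

    ─-adj : ∀ {p q} → Adj (G ─ F) p q ⇔ (Adj G p q × ¬ Adj F p q)
    ─-adj {p} {q} = T-∧-not (T? (has F p q))

    -- A junction w is charged to the edge uw, if this edge was removed, and otherwise to vw.
    junctions≤removed : ∀ {u v} (junction? : Decidable (Junction G u v)) → ¬ Within2 (G ─ F) u v →
      # junction? ≤ ∣ F ∣
    junctions≤removed {u} {v} junction? far =
      length-inject charge (Unique.filter⁺ junction? (Unique.allFin⁺ n)) (λ i → removed (junction i))
          (λ i j → injective (junction i) (junction j))
      where
      junction : ∀ {w} → w ∈ filter junction? (allFin n) → Junction G u v w
      junction i = proj₂ (∈-filter⁻ junction? {xs = allFin n} i)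
      charge : Fin n → Fin n × Fin n
      charge w with adj? F u w
      ... | yes _ = pair u w
      ... | no  _ = pair v w
      cut : ∀ {p q} → Adj G p q → ¬ Adj (G ─ F) p q → Adj F p q
      cut {p} {q} e gone = decidable-stable (adj? F p q) (λ ¬e → gone (from ─-adj (e , ¬e)))
      removed : ∀ {w} → Junction G u v w → charge w ∈ edges F
      removed {w} (u~w , v-w) with adj? F u w
      ... | yes e = pair∈edges F e
      ... | no ¬e = pair∈edges F (cut v~w (λ v~′w → far (w , inj₂ u~′w , inj₂ (adj-sym (G ─ F) v~′w))))
        where
        u~′w : Adj (G ─ F) u w
        u~′w = from ─-adj (u~w , ¬e)
        v~w : Adj G v w
        v~w = adj=⇒adj G (λ { refl → far (w , inj₂ u~′w , inj₁ refl) }) v-w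
      injective : ∀ {w w′} → Junction G u v w → Junction G u v w′ → charge w ≡ charge w′ → w ≡ w′
      injective {w} {w′} (u~w , _) (u~w′ , _) eq with adj? F u w | adj? F u w′
      ... | yes _ | yes _ = [ proj₂ , (λ (u≡w′ , w≡u) → trans w≡u u≡w′) ]′ (pair-ends eq)
      ... | no _  | no _  = [ proj₂ , (λ (v≡w′ , w≡v) → trans w≡v v≡w′) ]′ (pair-ends eq)
      ... | yes _ | no _  = [ proj₂ , (λ (u≡w′ , _) → ⊥-elim (adj⇒≢ G u~w′ u≡w′)) ]′ (pair-ends eq)
      ... | no _  | yes _ = [ proj₂ , (λ (_ , w≡u) → ⊥-elim (adj⇒≢ G u~w (sym w≡u))) ]′ (pair-ends eq)

  -- The edges deleted according to a good colouring

  module _ (G : Graph n) {u v : Fin n} (u≢v : u ≢ v) {f : Fin n → Bool} (g : Good G u v f) where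

    open Good g

    private
      -- The rule looks at an edge from the end `p`; an edge survives if it passes from both ends.
      -- As `u` is coloured true and `v` false, the edge `uv` is deleted without a clause of its
      -- own.
      Keep : (p q : Fin n) → Set
      Keep p q = (p ≡ u → f q ≡ true) × (p ≡ v → f q ≡ false)

      keep? : ∀ p q → Dec (Keep p q)
      keep? p q = (p ≟ u →-dec f q Bool.≟ true) ×-dec (p ≟ v →-dec f q Bool.≟ false)

      both? : ∀ p q → Dec (Keep p q × Keep q p)
      both? p q = keep? p q ×-dec keep? q p

    removal : EdgeSet n
    removal = record
      { has         = λ p q → has G p q ∧ not (does (both? p q))
      ; symmetric   = λ p q → cong₂ (λ a b → a ∧ not b) (symmetric G p q)
          (does-⇔ (mk⇔ swap swap) (both? p q) (both? q p))
      ; irreflexive = λ p → cong (_∧ not (does (both? p p))) (irreflexive G p) }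

    removal⊆ : removal ⊆ G
    removal⊆ p q = proj₁ ∘ to T-∧

    private
      H : Graph n
      H = G ─ removal

      removal-adj : ∀ {p q} → Adj removal p q ⇔ (Adj G p q × ¬ (Keep p q × Keep q p))
      removal-adj {p} {q} = T-∧-not (both? p q)

      stays : ∀ {p q} → Adj G p q → Keep p q → Keep q p → Adj H p q
      stays e k k′ = from (─-adj G removal) (e , λ r → proj₂ (to removal-adj r) (k , k′))

      stayed : ∀ {p q} → Adj H p q → Keep p q
      stayed {p} {q} e = let p~q , ¬r = to (─-adj G removal) e in
        proj₁ (decidable-stable (both? p q) (λ ¬k → ¬r (from removal-adj (p~q , ¬k))))

    removal-kept : Kept G u v f H
    removal-kept = record
      { kept-u = λ u~w fw → stays u~w ((λ _ → fw) , ⊥-elim ∘ u≢v)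
          ((λ _ → at-u) , λ { refl → ⊥-elim (true≢false (trans (sym fw) at-v)) })
      ; kept-v = λ v~w fw → stays v~w (⊥-elim ∘ u≢v ∘ sym , λ _ → fw)
          ((λ { refl → ⊥-elim (true≢false (trans (sym at-u) fw)) }) , λ _ → at-v)
      ; kept   = λ p≢u p≢v q≢u q≢v e → stays e (⊥-elim ∘ p≢u , ⊥-elim ∘ p≢v) (⊥-elim ∘ q≢u , ⊥-elim ∘ q≢v) }

    removal-far : ¬ Within2 H u v
    removal-far (m , u-m , m-v) = go u-m m-v
      where
      u≁v : ¬ Adj H u v
      u≁v e = true≢false (trans (sym (proj₁ (stayed e) refl)) at-v)
      go : ∀ {m} → Adj= H u m → Adj= H m v → ⊥
      go (inj₁ refl) (inj₁ eq)   = u≢v eq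
      go (inj₁ refl) (inj₂ e)    = u≁v e
      go (inj₂ e)    (inj₁ refl) = u≁v e
      go (inj₂ e)    (inj₂ e′)   = true≢false
          (trans (sym (proj₁ (stayed e) refl)) (proj₂ (stayed (adj-sym H e′)) refl))

    -- The charging of junctions in reverse: `owner w` is the edge that `w` gives up according to
    -- its colour. Every removed edge arises so, because private vertices keep their edges. The edge
    -- `uv` is owned by `v`, from whichever end it is met.
    removed≤junctions : (junction? : Decidable (Junction G u v)) → ∣ removal ∣ ≤ # junction?
    removed≤junctions junction? = ≤-trans
      (length-inject id {ys = map owner junctions} (edges-unique removal) owned (λ _ _ → id))
      (≤-reflexive (List.length-map owner junctions))
      where
      junctions : List (Fin n)
      junctions = filter junction? (allFin n)
      owner : Fin n → Fin n × Fin n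
      owner w = if f w then pair v w else pair u w
      owner-true : ∀ {w} → f w ≡ true → owner w ≡ pair v w
      owner-true fw rewrite fw = refl
      owner-false : ∀ {w} → f w ≡ false → owner w ≡ pair u w
      owner-false fw rewrite fw = refl
      junction∈ : ∀ {w} → Junction G u v w → owner w ∈ map owner junctions
      junction∈ {w} j = ∈-map⁺ owner (∈-filter⁺ junction? (∈-allFin w) j)
      v-end : ∀ {q} → Adj G v q → f q ≡ true → pair v q ∈ map owner junctions
      v-end {q} v~q fq with q ≟ u
      ... | yes refl = subst (_∈ map owner junctions) (trans (owner-false at-v) (pair-sym u≢v))
          (junction∈ (adj-sym G v~q , inj₁ refl))
      ... | no q≢u   = subst (_∈ map owner junctions) (owner-true fq) (junction∈ (u~q , inj₂ v~q))
        where
        u~q : Adj G u q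
        u~q = decidable-stable (adj? G u q) λ u≁q →
          true≢false (trans (sym fq) (private-v (v~q , λ { (inj₁ eq) → q≢u (sym eq) ; (inj₂ e) → u≁q e })))
      u-end : ∀ {q} → Adj G u q → f q ≡ false → pair u q ∈ map owner junctions
      u-end {q} u~q fq = subst (_∈ map owner junctions) (owner-false fq) (junction∈ (u~q ,
        decidable-stable (adj=? G v q) (λ v≁q → true≢false (trans (sym (private-u (u~q , v≁q))) fq))))
      end : ∀ {p q} → Adj G p q → ¬ Keep p q → pair p q ∈ map owner junctions
      end {p} {q} e ¬k with p ≟ u | p ≟ v | f q in fq
      ... | yes refl | _        | false = u-end e fq
      ... | yes refl | _        | true  = ⊥-elim (¬k ((λ _ → refl) , ⊥-elim ∘ u≢v))
      ... | no _     | yes refl | true  = v-end e fq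
      ... | no p≢u   | yes refl | false = ⊥-elim (¬k (⊥-elim ∘ p≢u , λ _ → refl))
      ... | no p≢u   | no p≢v   | _     = ⊥-elim (¬k (⊥-elim ∘ p≢u , ⊥-elim ∘ p≢v))
      owned : ∀ {e} → e ∈ edges removal → e ∈ map owner junctions
      owned {p , q} i with edges-sound removal i
      ... | p<q , r with to removal-adj r
      ...   | p~q , ¬k with keep? p q
      ...     | no ¬k₁ = subst (_∈ map owner junctions) (pair-< p<q) (end p~q ¬k₁)
      ...     | yes k₁ = subst (_∈ map owner junctions) (pair-> p<q) (end (adj-sym G p~q) (λ k₂ → ¬k (k₁ , k₂)))

-- The formula for 3-MEDA

size≥length : ∀ xs → length xs ≤ size xs
size≥length []       = z≤n
size≥length (x ∷ xs) = s≤s (≤-trans (size≥length xs) (m≤n+m _ _))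

length-product : ∀ {A B : Set} (xs : List A) (ys : List B) → length (cartesianProduct xs ys) ≡ length xs * length ys
length-product []       ys = refl
length-product (x ∷ xs) ys = trans (List.length-++ (map (x ,_) ys))
    (cong₂ _+_ (List.length-map (x ,_) ys) (length-product xs ys))

length-tape : ∀ {n} (G : Graph n) k → length (tape G k) ≡ suc (n * n)
length-tape {n} G k = cong suc (trans (List.length-map _ (cartesianProduct (allFin n) (allFin n)))
  (trans (length-product (allFin n) (allFin n)) (cong₂ _*_ length-allFin length-allFin)))
  where
  length-allFin : length (allFin n) ≡ n
  length-allFin = List.length-tabulate id

-- Every number of the encoding has at least one digit, so the size bounds the number of cells and
-- with it the order, which is all that the sums range over. The budget may be exponential in the
-- size, but it is only compared with a count and never bounds a sum.
definable⇒polynomial : ∀ d (φ : Formula 0) →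
  (∀ I → let open MEDAInstance I in Semantics.Holds graph budget [] φ ⇔ Problem.Yes (MEDA d) I) → PolynomialTime (MEDA d)
definable⇒polynomial d φ correct = program , time-bound , λ I → let open MEDAInstance I in
  not (val I ≡ᵇ 0) , decides (size (encodeMEDA I)) order (tape graph budget) (length-tape graph budget) (cells≤ I)
      (order≤ I) , reflects I
  where
  open Decider (truth φ)
  val : MEDAInstance → ℕ
  val I = value (nth (tape graph budget)) (order ∷ []) (truth φ)
    where open MEDAInstance I
  cells≤ : ∀ I → let open MEDAInstance I in suc (order * order) ≤ size (encodeMEDA I)
  cells≤ I = ≤-trans (≤-reflexive (sym (length-tape graph budget))) (≤-trans (n≤1+n _) (size≥length (encodeMEDA I)))
    where open MEDAInstance I
  n≤n*n : ∀ n → n ≤ n * n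
  n≤n*n zero    = z≤n
  n≤n*n (suc n) = m≤n*m (suc n) (suc n)
  order≤ : ∀ I → MEDAInstance.order I ≤ size (encodeMEDA I)
  order≤ I = ≤-trans (n≤n*n _) (≤-trans (n≤1+n _) (cells≤ I))
  reflects : ∀ I → Reflects (Problem.Yes (MEDA d) I) (not (val I ≡ᵇ 0))
  reflects I = go (val I) (truth-correct graph budget φ [])
    where
    open MEDAInstance I
    go : ∀ x → 0 < x ⇔ Semantics.Holds graph budget [] φ → Reflects (Problem.Yes (MEDA d) I) (not (x ≡ᵇ 0))
    go zero    e = ofⁿ λ yes → impossible (from e (from (correct I) yes))
      where
      impossible : ¬ 0 < 0
      impossible ()
    go (suc x) e = ofʸ (to (correct I) (to e (s≤s z≤n)))

adj=ᶠ : ∀ {m} (i j : Fin m) → Formula m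
adj=ᶠ i j = eqᶠ i j ∨ᶠ adjᶠ i j

within2ᶠ within3ᶠ : ∀ {m} (i j : Fin m) → Formula m
within2ᶠ i j = ∃ᶠ (adj=ᶠ (suc i) zero ∧ᶠ adj=ᶠ zero (suc j))
within3ᶠ i j = ∃ᶠ (adj=ᶠ (suc i) zero ∧ᶠ within2ᶠ zero (suc j))

nearᶠ : ∀ {m} (u v p q : Fin m) → Formula m
nearᶠ u v p q = ∃ᶠ ((¬ᶠ eqᶠ zero (suc u) ∧ᶠ ¬ᶠ eqᶠ zero (suc v)) ∧ᶠ adj=ᶠ (suc p) zero ∧ᶠ adj=ᶠ zero (suc q))

privateᶠ commonᶠ flankᶠ : ∀ {m} (u v w : Fin m) → Formula m
privateᶠ u v w = adjᶠ u w ∧ᶠ ¬ᶠ adj=ᶠ v w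
commonᶠ u v w  = adjᶠ u w ∧ᶠ adjᶠ v w
flankᶠ u v w   = (adjᶠ u w ∨ᶠ adjᶠ v w) ∧ᶠ ¬ᶠ eqᶠ w u ∧ᶠ ¬ᶠ eqᶠ w v

separableᶠ : ∀ {m} (u v x y : Fin m) → Formula m
separableᶠ u v x y =
  (adjᶠ u x ∧ᶠ ¬ᶠ eqᶠ x v) ∧ᶠ (adjᶠ v y ∧ᶠ ¬ᶠ eqᶠ y u) ∧ᶠ adjᶠ x y ∧ᶠ
  ∀ᶠ (privateᶠ (suc u) (suc v) zero ⇒ᶠ ∃ᶠ
     ((adjᶠ (2+ v) zero ∧ᶠ ¬ᶠ eqᶠ zero (2+ u)) ∧ᶠ ¬ᶠ eqᶠ zero (2+ x) ∧ᶠ nearᶠ (2+ u) (2+ v) (suc zero) zero)) ∧ᶠ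
  ∀ᶠ (privateᶠ (suc v) (suc u) zero ⇒ᶠ ∃ᶠ
     ((adjᶠ (2+ u) zero ∧ᶠ ¬ᶠ eqᶠ zero (2+ v)) ∧ᶠ ¬ᶠ eqᶠ zero (2+ y) ∧ᶠ nearᶠ (2+ u) (2+ v) (suc zero) zero)) ∧ᶠ
  ∀ᶠ (commonᶠ (suc u) (suc v) zero ⇒ᶠ ∃ᶠ
     (flankᶠ (2+ u) (2+ v) zero ∧ᶠ ¬ᶠ eqᶠ zero (suc zero) ∧ᶠ nearᶠ (2+ u) (2+ v) (suc zero) zero))
  where
  2+ : ∀ {m} → Fin m → Fin (suc (suc m))
  2+ i = suc (suc i)

-- Clause by clause in the shape of `Criterion`, so that `Holds` of it computes to the criterion and
-- the two implications apply to it without a translation.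
medaᶠ : Formula 0
medaᶠ = ∀ᶠ (∀ᶠ (within3ᶠ (suc zero) zero)) ∧ᶠ
  ∃ᶠ (∃ᶠ (¬ᶠ eqᶠ (suc zero) zero ∧ᶠ
          few (adjᶠ (suc (suc zero)) zero ∧ᶠ adj=ᶠ (suc zero) zero) ∧ᶠ
          ∃ᶠ (∃ᶠ (separableᶠ (suc (suc (suc zero))) (suc (suc zero)) (suc zero) zero))))

-- Equivalence of the criterion with solvability

module _ {n : ℕ} (G : Graph n) (k : ℕ) where

  open Semantics G k

  -- The decision procedure for Junction that the evaluation of medaᶠ uses.
  junction? : ∀ u v w → Dec (Junction G u v w)
  junction? u v w = holds? (w ∷ v ∷ u ∷ []) (adjᶠ (suc (suc zero)) zero ∧ᶠ adj=ᶠ (suc zero) zero)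

  -- One condition covers both possible diameters. `separable` does not restrict the diameter of
  -- `G`, so the condition is necessary in either case. If `G` already has a pair at distance 3, the
  -- first clause suffices; otherwise `G` has diameter at most 2 and a good colouring exists.
  Criterion : Set
  Criterion = (∀ p q → Within3 G p q) × ∃₂ λ u v → u ≢ v × # (junction? u v) ≤ k × ∃₂ (Separable G u v)

  Solvable : Set
  Solvable = ∃ λ F → F ⊆ G × ∣ F ∣ ≤ k × Connected (G ─ F) × IsDiam (G ─ F) 3

  solvable⇒criterion : Solvable → Criterion
  solvable⇒criterion (F , _ , F≤k , connected , diam) =
    (λ p q → within3-mono {G = G} {H} (λ p q → thins {p} {q}) (within3 p q)) ,
    u , v , far⇒≢ G H thins within3 far , ≤-trans (junctions≤removed G F (junction? u v) far) F≤k , separable G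
        H thins within3 far
    where
    H : Graph n
    H = G ─ F
    thins : ∀ {p q} → Adj H p q → Adj G p q
    thins e = proj₁ (to (─-adj G F) e)
    within3 : ∀ p q → Within3 H p q
    within3 = connected-diam3⇒within3 H connected diam
    u v : Fin n
    u = proj₁ (diam3⇒¬within2 H diam)
    v = proj₁ (proj₂ (diam3⇒¬within2 H diam))
    far : ¬ Within2 H u v
    far = proj₂ (proj₂ (diam3⇒¬within2 H diam))

  criterion⇒solvable : Criterion → Solvable
  criterion⇒solvable (within3 , u , v , u≢v , few-junctions , x , y , sep)
    with Fin.any? (λ p → Fin.any? (λ q → ¬? (within2? G p q)))
  -- All distances are at most 3 and one is not at most 2, so deleting nothing is a solution.
  ... | yes (p , q , far) = F₀ , (λ _ _ ()) , ≤-trans (≤-reflexive no-edges) z≤n ,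
      within3⇒connected-diam3 (G ─ F₀) (λ s t → within3-mono {G = G ─ F₀} {G} all-stay (within3 s t))
          (λ w → far (within2-mono {G = G} {G ─ F₀} (λ s t e → proj₁ (to (─-adj G F₀ {s} {t}) e)) w))
    where
    F₀ : EdgeSet n
    F₀ = record { has = λ _ _ → false ; symmetric = λ _ _ → refl ; irreflexive = λ _ → refl }
    no-edges : ∣ F₀ ∣ ≡ 0
    no-edges = cong length (List.filter-none _ (All.universal (λ _ ()) (cartesianProduct (allFin n) (allFin n))))
    all-stay : ∀ s t → Adj G s t → Adj (G ─ F₀) s t
    all-stay s t e = from (─-adj G F₀ {s} {t}) (e , λ ())
  ... | no close = removal G u≢v good , removal⊆ G u≢v good , ≤-trans
      (removed≤junctions G u≢v good (junction? u v)) few-junctions ,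
      within3⇒connected-diam3 (G ─ removal G u≢v good) (good⇒within3 G within2 good (removal-kept G u≢v good))
          (removal-far G u≢v good)
    where
    within2 : ∀ p q → Within2 G p q
    within2 p q = decidable-stable (within2? G p q) (λ far → close (p , q , far))
    good : Good G u v _
    good = proj₂ (separable⇒good G within2 u≢v sep)

theorem4p5 : PolynomialTime (MEDA 3)
theorem4p5 = definable⇒polynomial 3 medaᶠ λ I → let open MEDAInstance I in
  mk⇔ (criterion⇒solvable graph budget) (solvable⇒criterion graph budget)
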